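{- Let $k\ge 2$ be a constant integer. Consider a \textsc{MotifCC} instance on node set $V$ whose weights satisfy probability constraints, i.e. $w^+_{\mathcal{E}}+w^-_{\mathcal{E}}=1$ for every $\mathcal{E}\in E_k$. Run the Generalized CGW algorithm with $\gamma=1/(2(k-1))$ and $\delta=1/2$, with arbitrary choices of the nodes $u$. The clustering it outputs has \textsc{MotifCC} cost at most $4(k-1)$ times the optimal \textsc{MotifCC} cost.
   Context: \textsc{MotifCC}: $V$ is a set of $n$ nodes and $E_k$ is the set of all $k$-element subsets ("$k$-tuples", "hyperedges") of $V$. Each $\mathcal{E}\in E_k$ has weights $w^+_{\mathcal{E}},w^-_{\mathcal{E}}\ge 0$. A clustering (a partition of $V$) pays $w^+_{\mathcal{E}}$ for each $\mathcal{E}$ whose nodes are not all in one cluster, and $w^-_{\mathcal{E}}$ for each $\mathcal{E}$ whose nodes all lie in one cluster; the total is its cost. LP relaxation: variables $x_{uv}$ for unordered pairs of distinct nodes, and $x_{\mathcal{E}}$ for $\mathcal{E}\in E_k$. It minimizes $\sum_{\mathcal{E}\in E_k} w^+_{\mathcal{E}}x_{\mathcal{E}}+w^-_{\mathcal{E}}(1-x_{\mathcal{E}})$ subject to the following constraints: $x_{uv}\le x_{uw}+x_{vw}$ for all distinct $u,v,w$; $0\le x_{uv}\le 1$; $x_{uv}\le x_{\mathcal{E}}$ for all distinct $u,v\in\mathcal{E}$; $(k-1)x_{\mathcal{E}}\le\sum_{\{u,v\}\subseteq\mathcal{E}}x_{uv}$; and $0\le x_{\mathcal{E}}\le 1$.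 By convention $x_{uu}=0$. Generalized CGW algorithm with parameters $\gamma,\delta$: solve the LP relaxation to obtain $(x_{ij})$. Set $W=V$. While $W\ne\emptyset$: choose $u\in W$ arbitrarily and let $T_u=\{i\in W\setminus\{u\}: x_{ui}\le\gamma\}$. If $\sum_{i\in T_u}x_{ui}<\gamma\delta|T_u|$, let $S=\{u\}\cup T_u$; otherwise let $S=\{u\}$. Output $S$ as a cluster and set $W\leftarrow W\setminus S$.
   Formalization: The weights and the optimal LP solution (the values x_uv and x_E) that the algorithm uses are taken to be rational numbers instead of real numbers. -}

module Defs where

open import Data.Bool using (Bool; true; false; if_then_else_; _∧_; not)
open import Data.Nat as ℕ using (ℕ; zero; suc; _∸_)
open import Data.Integer using (+_)
open import Data.Rational using (ℚ; 0ℚ; 1ℚ; _+_; _*_; _-_; _≤_; _≤ᵇ_; _/_)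
open import Data.Fin using (Fin)
open import Data.Fin.Properties using () renaming (_≟_ to _≟F_; _<?_ to _<F?_)
open import Data.Fin.Subset using (Subset; ∣_∣; _∈_; ⁅_⁆; _∪_; _─_; ⊥)
open import Data.Fin.Subset.Properties using (_∈?_; _⊆?_)
open import Data.List using (List; []; _∷_; [_]; map; _++_; filter; foldr; concatMap; allFin)
open import Data.Bool.ListAction using (all; any)
open import Data.Vec using (Vec; tabulate; lookup) renaming ([] to []ᵥ; _∷_ to _∷ᵥ_)
open import Data.Product using (_×_; _,_)
open import Relation.Nullary using (¬_)
open import Relation.Nullary.Decidable using (⌊_⌋)
open import Relation.Binary.PropositionalEquality using (_≡_; _≢_)

allSubsets : (n : ℕ) → List (Subset n)
allSubsets zero = [ []ᵥ ]
allSubsets (suc n) = map (true ∷ᵥ_) (allSubsets n) ++ map (false ∷ᵥ_) (allSubsets n)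

kSubsets : (n k : ℕ) → List (Subset n)
kSubsets n k = filter (λ s → ∣ s ∣ ℕ.≟ k) (allSubsets n)

sumℚ : List ℚ → ℚ
sumℚ = foldr _+_ 0ℚ

ℕtoℚ : ℕ → ℚ
ℕtoℚ m = (+ m) / 1

-- 1/d for d ≥ 1 (value 0 at d = 0, never used)
invℕ : ℕ → ℚ
invℕ zero = 0ℚ
invℕ (suc d) = (+ 1) / suc d

_<ᵇ_ : ℚ → ℚ → Bool
p <ᵇ q = not (q ≤ᵇ p)

members : {n : ℕ} → Subset n → List (Fin n)
members {n} s = filter (λ i → i ∈? s) (allFin n)

pairsOf : {n : ℕ} → Subset n → List (Fin n × Fin n)
pairsOf E = concatMap (λ u → map (u ,_) (filter (λ v → u <F? v) (members E))) (members E)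

-- MotifCC cost of a clustering described by the predicate "E lies in one cluster"
cost : (n k : ℕ) (w⁺ w⁻ : Subset n → ℚ) (uncut : Subset n → Bool) → ℚ
cost n k w⁺ w⁻ uncut =
  sumℚ (map (λ E → if uncut E then w⁻ E else w⁺ E) (kSubsets n k))

uncutLabel : {n : ℕ} → (Fin n → ℕ) → Subset n → Bool
uncutLabel c E = all (λ { (u , v) → ⌊ c u ℕ.≟ c v ⌋ }) (pairsOf E)

uncutClusters : {n : ℕ} → List (Subset n) → Subset n → Bool
uncutClusters Ss E = any (λ S → ⌊ E ⊆? S ⌋) Ss

record LPFeasible (n k : ℕ) (x : Fin n → Fin n → ℚ) (xE : Subset n → ℚ) : Set where
  field
    symm   : ∀ u v → x u v ≡ x v u
    diag   : ∀ u → x u u ≡ 0ℚ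
    tri    : ∀ u v w → u ≢ v → v ≢ w → u ≢ w → x u v ≤ x u w + x v w
    x-lo   : ∀ u v → 0ℚ ≤ x u v
    x-hi   : ∀ u v → x u v ≤ 1ℚ
    edge   : ∀ E → ∣ E ∣ ≡ k → ∀ u v → u ∈ E → v ∈ E → u ≢ v → x u v ≤ xE E
    sumcon : ∀ E → ∣ E ∣ ≡ k →
             ℕtoℚ (k ∸ 1) * xE E ≤ sumℚ (map (λ { (u , v) → x u v }) (pairsOf E))
    xE-lo  : ∀ E → ∣ E ∣ ≡ k → 0ℚ ≤ xE E
    xE-hi  : ∀ E → ∣ E ∣ ≡ k → xE E ≤ 1ℚ

LPobj : (n k : ℕ) (w⁺ w⁻ : Subset n → ℚ) (xE : Subset n → ℚ) → ℚ
LPobj n k w⁺ w⁻ xE =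
  sumℚ (map (λ E → w⁺ E * xE E + w⁻ E * (1ℚ - xE E)) (kSubsets n k))

record LPOptimal (n k : ℕ) (w⁺ w⁻ : Subset n → ℚ)
                 (x : Fin n → Fin n → ℚ) (xE : Subset n → ℚ) : Set where
  field
    feasible : LPFeasible n k x xE
    optimal  : ∀ y yE → LPFeasible n k y yE → LPobj n k w⁺ w⁻ xE ≤ LPobj n k w⁺ w⁻ yE

Tset : {n : ℕ} (γ : ℚ) (x : Fin n → Fin n → ℚ) (W : Subset n) (u : Fin n) → Subset n
Tset γ x W u = tabulate (λ i → lookup W i ∧ not ⌊ i ≟F u ⌋ ∧ (x u i ≤ᵇ γ))

clusterOf : {n : ℕ} (γ δ : ℚ) (x : Fin n → Fin n → ℚ) (W : Subset n) (u : Fin n) → Subset n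
clusterOf γ δ x W u =
  if sumℚ (map (x u) (members T)) <ᵇ (γ * δ * ℕtoℚ ∣ T ∣)
  then ⁅ u ⁆ ∪ T
  else ⁅ u ⁆
  where T = Tset γ x W u

-- CGWRun γ δ x W Ss : starting from remaining set W, the algorithm (with some
-- sequence of arbitrary pivot choices) outputs the clusters Ss in order.
data CGWRun {n : ℕ} (γ δ : ℚ) (x : Fin n → Fin n → ℚ) : Subset n → List (Subset n) → Set where
  done : CGWRun γ δ x ⊥ []
  step : ∀ {W Ss} (u : Fin n) → u ∈ W →
         CGWRun γ δ x (W ─ clusterOf γ δ x W u) Ss →
         CGWRun γ δ x W (clusterOf γ δ x W u ∷ Ss)

gammaK : ℕ → ℚ
gammaK k = invℕ (2 ℕ.* (k ∸ 1))

{-# OPTIONS --safe #-}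
-- Fix a pivot u and scale distances by M = 4(k − 1): d i = M · x u i and D E = M · xE E. Every k-set E satisfies
-- d j − d i ≤ D E for i, j ∈ E and, by the pair-sum constraint and the triangle inequality, D E ≤ Σ_{i ∈ E} d i;
-- nodes of T have d ≤ 2, the remaining nodes other than u have d ≥ 2. The k-sets first met by the cluster of u
-- are grouped into classes with a common trace outside T (or outside the cluster). In a class either every set
-- pays at most M times its LP cost, or the difference is bounded below by the average over E ∩ T (or over E ∩ S)
-- of ± (1 − d i); averaging over a class reproduces the average over T (or S), whose sign is the one tested by
-- the algorithm. Summing over all steps gives cost ≤ M · LP, and a clustering is an integral LP solution.

module Submission where

open import Defs

-- No bound holds set by set: a cut set with `D E < 1`, or an uncut set with `D E > M - 1`, can pay
-- more than M times its LP cost. What makes averaging possible is the probability constraint: it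
-- turns the difference between M times the LP cost and the payment into a convex combination of two
-- linear functions of `D E`. A lower bound then amounts to two inequalities in `D E` alone, so the
-- weights, which vary freely within a class, disappear before any average is taken. The constants
-- come from `M * γ = 2` and `M * γ * ½ = 1`: the radius of T becomes 2, and the test compares the
-- average distance with 1. Uncut sets are harmless for k ≥ 3, where `D E ≤ 2 k ≤ M - 1`. For k = 2
-- this fails, since `D E` may reach 4 while M - 1 = 3, and the pairs inside a cluster need an
-- averaging argument of their own.

module CGW where

  open import Data.Bool as Bool using (Bool; true; false; if_then_else_; _∧_; _∨_; not)
  open import Data.Nat as ℕ using (ℕ; zero; suc)
  import Data.Nat.Properties as ℕₚ
  import Data.Integer as ℤ
  import Data.Integer.Properties as ℤₚ
  open import Data.Rational using (ℚ; 0ℚ; 1ℚ; ½; _+_; _*_; _-_; -_; _≤_; _≤ᵇ_; toℚᵘ; nonNegative)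
  open import Data.Rational.Properties
  import Data.Rational.Unnormalised as ℚᵘ
  import Data.Rational.Unnormalised.Properties as ℚᵘₚ
  open import Data.Fin using (Fin; zero; suc)
  import Data.Fin as Fin
  import Data.Fin.Properties as Finₚ
  open import Data.Fin.Subset using (Subset; ∣_∣; _∈_; _∉_; _⊆_; ⁅_⁆; _∪_; _∩_; _─_; ⊥; ⊤) renaming (_-_ to _∖_)
  open import Data.Fin.Subset.Properties
  open import Data.List as List using (List; []; _∷_; map; filter; concatMap; _++_)
  open import Data.List.Membership.Propositional using () renaming (_∈_ to _∈ₗ_)
  open import Data.List.Membership.Propositional.Properties using (∈-concatMap⁺; ∈-concatMap⁻; ∈-filter⁺; ∈-filter⁻; ∈-map⁺; ∈-map⁻; ∈-allFin)
  open import Data.List.Relation.Unary.Any as Any using (here; there)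
  open import Data.Bool.ListAction using (all)
  open import Data.List.Properties using (map-cong)
  open import Data.Vec as Vec using ([]; _∷_; here; there)
  open import Data.Product using (_×_; _,_; ∃; proj₁; proj₂)
  open import Data.Sum using (_⊎_; inj₁; inj₂; [_,_]′)
  open import Data.Vec.Properties using (lookup∘tabulate; []=⇒lookup; lookup⇒[]=)
  open import Data.Unit using (tt)
  open import Data.Empty using (⊥-elim)
  open import Function using (_∘_; id)
  open import Level using (0ℓ)
  open import Relation.Nullary using (¬_; Dec; yes; no; does)
  open import Relation.Nullary.Decidable using (dec⇒maybe; ⌊_⌋; ¬?; decidable-stable; _×-dec_; _⊎-dec_)
  open import Relation.Unary using (Pred; Decidable)
  open import Relation.Binary.Definitions using (tri<; tri≈; tri>)
  open import Relation.Binary.PropositionalEquality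
  open import Tactic.RingSolver using (solve-∀)
  open import Tactic.RingSolver.Core.AlmostCommutativeRing using (AlmostCommutativeRing; fromCommutativeRing)

  -- Ordered arithmetic of the rationals.

  ℚ-ring : AlmostCommutativeRing 0ℓ 0ℓ
  ℚ-ring = fromCommutativeRing +-*-commutativeRing (λ p → dec⇒maybe (0ℚ ≟ p))

  2ℚ 3ℚ 4ℚ : ℚ
  2ℚ = 1ℚ + 1ℚ
  3ℚ = 1ℚ + 2ℚ
  4ℚ = 1ℚ + 3ℚ

  p≤q⇒0≤q-p : ∀ {p q} → p ≤ q → 0ℚ ≤ q - p
  p≤q⇒0≤q-p {p} {q} p≤q = subst (_≤ q - p) (+-inverseʳ p) (+-monoˡ-≤ (- p) p≤q)

  0≤q-p⇒p≤q : ∀ {p q} → 0ℚ ≤ q - p → p ≤ q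
  0≤q-p⇒p≤q {p} {q} 0≤q-p = subst₂ _≤_ (+-identityˡ p) (cancel q p) (+-monoˡ-≤ p 0≤q-p)
    where
    cancel : ∀ q p → q - p + p ≡ q
    cancel = solve-∀ ℚ-ring

  0≤p+q : ∀ {p q} → 0ℚ ≤ p → 0ℚ ≤ q → 0ℚ ≤ p + q
  0≤p+q = +-mono-≤

  0≤p*q : ∀ {p q} → 0ℚ ≤ p → 0ℚ ≤ q → 0ℚ ≤ p * q
  0≤p*q {p} {q} 0≤p 0≤q = subst (_≤ p * q) (*-zeroʳ p) (*-monoˡ-≤-nonNeg p {{nonNegative 0≤p}} 0≤q)

  *-mono-≤ˡ : ∀ {r p q} → 0ℚ ≤ r → p ≤ q → r * p ≤ r * q
  *-mono-≤ˡ {r} 0≤r = *-monoˡ-≤-nonNeg r {{nonNegative 0≤r}}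

  -- The pattern of most inequalities below: the difference is written as a combination `r` of
  -- products of nonnegative quantities, the ring solver checks the identity, and nonnegativity of
  -- `r` is read off from its shape.
  ≤-by : ∀ {p q r} → q - p ≡ r → 0ℚ ≤ r → p ≤ q
  ≤-by eq 0≤r = 0≤q-p⇒p≤q (subst (0ℚ ≤_) (sym eq) 0≤r)

  0≤1 : 0ℚ ≤ 1ℚ
  0≤1 = nonNegative⁻¹ 1ℚ

  ℕtoℚ-suc : ∀ m → ℕtoℚ (suc m) ≡ 1ℚ + ℕtoℚ m
  ℕtoℚ-suc m = toℚᵘ-injective (begin
    toℚᵘ (ℕtoℚ (suc m))                     ≈⟨ toℚᵘ-fromℚᵘ (ℚᵘ.mkℚᵘ (ℤ.+ suc m) 0) ⟩
    ℚᵘ.mkℚᵘ (ℤ.+ suc m) 0                     ≈⟨ ℚᵘ.*≡* (cong (λ z → (ℤ.+ 1 ℤ.+ z) ℤ.* ℤ.+ 1) (sym (ℤₚ.*-identityʳ (ℤ.+ m)))) ⟩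
    ℚᵘ.1ℚᵘ ℚᵘ.+ ℚᵘ.mkℚᵘ (ℤ.+ m) 0             ≈⟨ ℚᵘₚ.+-congʳ ℚᵘ.1ℚᵘ (ℚᵘₚ.≃-sym (toℚᵘ-fromℚᵘ (ℚᵘ.mkℚᵘ (ℤ.+ m) 0))) ⟩
    ℚᵘ.1ℚᵘ ℚᵘ.+ toℚᵘ (ℕtoℚ m)               ≈⟨ ℚᵘₚ.≃-sym (toℚᵘ-homo-+ 1ℚ (ℕtoℚ m)) ⟩
    toℚᵘ (1ℚ + ℕtoℚ m)                      ∎)
    where open ℚᵘₚ.≃-Reasoning

  ℕtoℚ-+ : ∀ m n → ℕtoℚ (m ℕ.+ n) ≡ ℕtoℚ m + ℕtoℚ n
  ℕtoℚ-+ zero n = sym (+-identityˡ (ℕtoℚ n))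
  ℕtoℚ-+ (suc m) n = begin
    ℕtoℚ (suc (m ℕ.+ n))         ≡⟨ ℕtoℚ-suc (m ℕ.+ n) ⟩
    1ℚ + ℕtoℚ (m ℕ.+ n)          ≡⟨ cong (1ℚ +_) (ℕtoℚ-+ m n) ⟩
    1ℚ + (ℕtoℚ m + ℕtoℚ n)       ≡⟨ +-assoc 1ℚ (ℕtoℚ m) (ℕtoℚ n) ⟨
    1ℚ + ℕtoℚ m + ℕtoℚ n         ≡⟨ cong (_+ ℕtoℚ n) (ℕtoℚ-suc m) ⟨
    ℕtoℚ (suc m) + ℕtoℚ n        ∎
    where open ≡-Reasoning

  0≤ℕtoℚ : ∀ m → 0ℚ ≤ ℕtoℚ m
  0≤ℕtoℚ zero = ≤-refl
  0≤ℕtoℚ (suc m) = subst (0ℚ ≤_) (sym (ℕtoℚ-suc m)) (0≤p+q 0≤1 (0≤ℕtoℚ m))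

  1≤ℕtoℚ-suc : ∀ m → 1ℚ ≤ ℕtoℚ (suc m)
  1≤ℕtoℚ-suc m = subst₂ _≤_ (+-identityʳ 1ℚ) (sym (ℕtoℚ-suc m)) (+-monoʳ-≤ 1ℚ (0≤ℕtoℚ m))

  ℕtoℚ*invℕ : ∀ d → ℕtoℚ (suc d) * invℕ (suc d) ≡ 1ℚ
  ℕtoℚ*invℕ d = toℚᵘ-injective (begin
    toℚᵘ (ℕtoℚ (suc d) * invℕ (suc d))              ≈⟨ toℚᵘ-homo-* (ℕtoℚ (suc d)) (invℕ (suc d)) ⟩
    toℚᵘ (ℕtoℚ (suc d)) ℚᵘ.* toℚᵘ (invℕ (suc d))    ≈⟨ ℚᵘₚ.*-cong (toℚᵘ-fromℚᵘ (ℚᵘ.mkℚᵘ (ℤ.+ suc d) 0)) (toℚᵘ-fromℚᵘ (ℚᵘ.mkℚᵘ (ℤ.+ 1) d)) ⟩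
    ℚᵘ.mkℚᵘ (ℤ.+ suc d) 0 ℚᵘ.* ℚᵘ.mkℚᵘ (ℤ.+ 1) d        ≈⟨ ℚᵘ.*≡* (cong ℤ.+_ (lem d)) ⟩
    ℚᵘ.1ℚᵘ                                          ∎)
    where
    open ℚᵘₚ.≃-Reasoning
    lem : ∀ d → suc d ℕ.* 1 ℕ.* 1 ≡ 1 ℕ.* (1 ℕ.* suc d)
    lem d = trans (ℕₚ.*-identityʳ _) (trans (ℕₚ.*-comm (suc d) 1) (sym (ℕₚ.*-identityˡ _)))

  0≤invℕ : ∀ d → 0ℚ ≤ invℕ d
  0≤invℕ zero = ≤-refl
  0≤invℕ (suc d) = nonNegative⁻¹ (invℕ (suc d)) {{normalize-nonNeg 1 (suc d)}}

  -- Sums over the elements of a subset.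

  when : Bool → ℚ → ℚ
  when b q = if b then q else 0ℚ

  -- Recursion on the characteristic vector, rather than on the list `members E`, lets sums compute
  -- along `∩`, `─` and the classes defined by `agree`.
  sumIn : ∀ {n} → Subset n → (Fin n → ℚ) → ℚ
  sumIn []          f = 0ℚ
  sumIn (true ∷ E)  f = f zero + sumIn E (f ∘ suc)
  sumIn (false ∷ E) f = sumIn E (f ∘ suc)

  sumIn-cong : ∀ {n} (E : Subset n) {f g} → (∀ i → i ∈ E → f i ≡ g i) → sumIn E f ≡ sumIn E g
  sumIn-cong []          eq = refl
  sumIn-cong (true ∷ E)  eq = cong₂ _+_ (eq zero here) (sumIn-cong E (λ i i∈E → eq (suc i) (there i∈E)))
  sumIn-cong (false ∷ E) eq = sumIn-cong E (λ i i∈E → eq (suc i) (there i∈E))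

  sumIn-mono : ∀ {n} (E : Subset n) {f g} → (∀ i → i ∈ E → f i ≤ g i) → sumIn E f ≤ sumIn E g
  sumIn-mono []          le = ≤-refl
  sumIn-mono (true ∷ E)  le = +-mono-≤ (le zero here) (sumIn-mono E (λ i i∈E → le (suc i) (there i∈E)))
  sumIn-mono (false ∷ E) le = sumIn-mono E (λ i i∈E → le (suc i) (there i∈E))

  sumIn-const : ∀ {n} (E : Subset n) c → sumIn E (λ _ → c) ≡ ℕtoℚ ∣ E ∣ * c
  sumIn-const []          c = sym (*-zeroˡ c)
  sumIn-const (true ∷ E)  c = begin
    c + sumIn E (λ _ → c)     ≡⟨ cong (c +_) (sumIn-const E c) ⟩
    c + ℕtoℚ ∣ E ∣ * c        ≡⟨ factor c (ℕtoℚ ∣ E ∣) ⟩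
    (1ℚ + ℕtoℚ ∣ E ∣) * c     ≡⟨ cong (_* c) (ℕtoℚ-suc ∣ E ∣) ⟨
    ℕtoℚ (suc ∣ E ∣) * c      ∎
    where
    open ≡-Reasoning
    factor : ∀ c m → c + m * c ≡ (1ℚ + m) * c
    factor = solve-∀ ℚ-ring
  sumIn-const (false ∷ E) c = sumIn-const E c

  sumIn-zero : ∀ {n} (E : Subset n) {f} → (∀ i → i ∈ E → f i ≡ 0ℚ) → sumIn E f ≡ 0ℚ
  sumIn-zero E f≡0 = trans (sumIn-cong E f≡0) (trans (sumIn-const E 0ℚ) (*-zeroʳ (ℕtoℚ ∣ E ∣)))

  0≤sumIn : ∀ {n} (E : Subset n) {f} → (∀ i → i ∈ E → 0ℚ ≤ f i) → 0ℚ ≤ sumIn E f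
  0≤sumIn E 0≤f = subst (_≤ sumIn E _) (sumIn-zero E (λ _ _ → refl)) (sumIn-mono E 0≤f)

  +-interchange : ∀ a b c d → a + b + (c + d) ≡ a + c + (b + d)
  +-interchange = solve-∀ ℚ-ring

  +-swap : ∀ a b c → a + (b + c) ≡ b + (a + c)
  +-swap = solve-∀ ℚ-ring

  sumIn-+ : ∀ {n} (E : Subset n) f g → sumIn E (λ i → f i + g i) ≡ sumIn E f + sumIn E g
  sumIn-+ []          f g = refl
  sumIn-+ (true ∷ E)  f g = trans (cong (f zero + g zero +_) (sumIn-+ E _ _)) (+-interchange (f zero) (g zero) _ _)
  sumIn-+ (false ∷ E) f g = sumIn-+ E _ _

  sumIn-* : ∀ {n} (E : Subset n) c f → sumIn E (λ i → c * f i) ≡ c * sumIn E f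
  sumIn-* []          c f = sym (*-zeroʳ c)
  sumIn-* (true ∷ E)  c f = trans (cong (c * f zero +_) (sumIn-* E c _)) (sym (*-distribˡ-+ c (f zero) _))
  sumIn-* (false ∷ E) c f = sumIn-* E c _

  sumIn-1- : ∀ {n} (E : Subset n) f → sumIn E (λ i → 1ℚ - f i) ≡ ℕtoℚ ∣ E ∣ - sumIn E f
  sumIn-1- E f = trans (sumIn-cong E (λ i _ → as-+ (f i))) (trans (sumIn-+ E (λ _ → 1ℚ) (λ i → - 1ℚ * f i))
    (trans (cong₂ _+_ (sumIn-const E 1ℚ) (sumIn-* E (- 1ℚ) f)) (as-- (ℕtoℚ ∣ E ∣) (sumIn E f))))
    where
    as-+ : ∀ p → 1ℚ - p ≡ 1ℚ + - 1ℚ * p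
    as-+ = solve-∀ ℚ-ring
    as-- : ∀ p q → p * 1ℚ + - 1ℚ * q ≡ p - q
    as-- = solve-∀ ℚ-ring

  sumIn--1 : ∀ {n} (E : Subset n) f → sumIn E (λ i → f i - 1ℚ) ≡ sumIn E f - ℕtoℚ ∣ E ∣
  sumIn--1 E f = trans (sumIn-+ E f (λ _ → - 1ℚ)) (cong (sumIn E f +_) (trans (sumIn-const E (- 1ℚ)) (neg (ℕtoℚ ∣ E ∣))))
    where
    neg : ∀ p → p * - 1ℚ ≡ - p
    neg = solve-∀ ℚ-ring

  sumIn-swap : ∀ {m n} (E : Subset m) (F : Subset n) (f : Fin m → Fin n → ℚ) →
               sumIn E (λ i → sumIn F (f i)) ≡ sumIn F (λ j → sumIn E (λ i → f i j))
  sumIn-swap []          F f = sym (sumIn-zero F (λ _ _ → refl))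
  sumIn-swap (true ∷ E)  F f = trans (cong (sumIn F (f zero) +_) (sumIn-swap E F (f ∘ suc))) (sym (sumIn-+ F (f zero) _))
  sumIn-swap (false ∷ E) F f = sumIn-swap E F (f ∘ suc)

  sumIn-split : ∀ {n} (E S : Subset n) f → sumIn E f ≡ sumIn (E ∩ S) f + sumIn (E ─ S) f
  sumIn-split []          []          f = refl
  sumIn-split (true ∷ E)  (true ∷ S)  f = trans (cong (f zero +_) (sumIn-split E S _)) (sym (+-assoc (f zero) _ _))
  sumIn-split (true ∷ E)  (false ∷ S) f = trans (cong (f zero +_) (sumIn-split E S (f ∘ suc)))
                                                (+-swap (f zero) (sumIn (E ∩ S) (f ∘ suc)) (sumIn (E ─ S) (f ∘ suc)))
  sumIn-split (false ∷ E) (true ∷ S)  f = sumIn-split E S _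
  sumIn-split (false ∷ E) (false ∷ S) f = sumIn-split E S _

  sumIn-remove : ∀ {n} (E : Subset n) {p} f → p ∈ E → sumIn E f ≡ f p + sumIn (E ∖ p) f
  sumIn-remove (true ∷ E)  {zero}  f here        = cong (λ F → f zero + sumIn F (f ∘ suc)) (sym (p─⊥≡p E))
  sumIn-remove (true ∷ E)  {suc p} f (there p∈E) =
    trans (cong (f zero +_) (sumIn-remove E (f ∘ suc) p∈E)) (+-swap (f zero) (f (suc p)) (sumIn (E ∖ p) (f ∘ suc)))
  sumIn-remove (false ∷ E) {suc p} f (there p∈E) = sumIn-remove E (f ∘ suc) p∈E

  x∈p─q⇒x∉q : ∀ {n} (p q : Subset n) {i} → i ∈ p ─ q → i ∉ q
  x∈p─q⇒x∉q (_ ∷ p) (true ∷ q)  {zero}  ()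
  x∈p─q⇒x∉q (_ ∷ p) (false ∷ q) {zero}  here ()
  x∈p─q⇒x∉q (_ ∷ p) (_ ∷ q)     {suc i} (there i∈) (there i∈q) = x∈p─q⇒x∉q p q i∈ i∈q

  x∈p∖y⇒x≢y : ∀ {n} (p : Subset n) {x y} → x ∈ p ∖ y → x ≢ y
  x∈p∖y⇒x≢y p {y = y} x∈ refl = x∈p─q⇒x∉q p ⁅ y ⁆ x∈ (x∈⁅x⁆ y)

  sumIn-single : ∀ {n} (E : Subset n) {p} f → p ∈ E → (∀ i → i ∈ E → i ≢ p → f i ≡ 0ℚ) → sumIn E f ≡ f p
  sumIn-single E {p} f p∈E off = begin
    sumIn E f                  ≡⟨ sumIn-remove E f p∈E ⟩
    f p + sumIn (E ∖ p) f      ≡⟨ cong (f p +_) (sumIn-zero (E ∖ p) (λ i i∈ → off i (p─q⊆p E ⁅ p ⁆ i∈) (x∈p∖y⇒x≢y E i∈))) ⟩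
    f p + 0ℚ                   ≡⟨ +-identityʳ (f p) ⟩
    f p                        ∎
    where open ≡-Reasoning

  sumIn-pair : ∀ {n} (E : Subset n) {p q} f → p ∈ E → q ∈ E → p ≢ q →
               (∀ i → i ∈ E → i ≢ p → i ≢ q → f i ≡ 0ℚ) → sumIn E f ≡ f p + f q
  sumIn-pair E {p} {q} f p∈E q∈E p≢q off =
    trans (sumIn-remove E f p∈E)
          (cong (f p +_) (sumIn-single (E ∖ p) f (x∈p∧x≢y⇒x∈p-y q∈E (p≢q ∘ sym))
            (λ i i∈ → off i (p─q⊆p E ⁅ p ⁆ i∈) (x∈p∖y⇒x≢y E i∈))))

  two-terms≤sumIn : ∀ {n} (E : Subset n) {p q} f → p ∈ E → q ∈ E → p ≢ q →
                    (∀ i → i ∈ E → 0ℚ ≤ f i) → f p + f q ≤ sumIn E f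
  two-terms≤sumIn E {p} {q} f p∈E q∈E p≢q 0≤f =
    subst (f p + f q ≤_) (sym (trans (sumIn-remove E f p∈E) (cong (f p +_) (sumIn-remove (E ∖ p) f q∈E∖p))))
      (≤-by (cert (f p) (f q) rest) (0≤sumIn ((E ∖ p) ∖ q) (λ i i∈ → 0≤f i (p─q⊆p E ⁅ p ⁆ (p─q⊆p (E ∖ p) ⁅ q ⁆ i∈)))))
    where
    rest = sumIn ((E ∖ p) ∖ q) f
    q∈E∖p = x∈p∧x≢y⇒x∈p-y q∈E (p≢q ∘ sym)
    cert : ∀ a b r → a + (b + r) - (a + b) ≡ r
    cert = solve-∀ ℚ-ring

  -- List sums of the definitions as recursive sums, and double counting of pairs.

  sum-filter : ∀ {A : Set} {P : Pred A 0ℓ} (P? : Decidable P) (f : A → ℚ) xs →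
               sumℚ (map f (filter P? xs)) ≡ sumℚ (map (λ x → when (does (P? x)) (f x)) xs)
  sum-filter P? f [] = refl
  sum-filter P? f (x ∷ xs) with does (P? x)
  ... | true  = cong (f x +_) (sum-filter P? f xs)
  ... | false = trans (sum-filter P? f xs) (sym (+-identityˡ _))

  sum-++ : ∀ {A : Set} (f : A → ℚ) xs ys → sumℚ (map f (xs ++ ys)) ≡ sumℚ (map f xs) + sumℚ (map f ys)
  sum-++ f []       ys = sym (+-identityˡ _)
  sum-++ f (x ∷ xs) ys = trans (cong (f x +_) (sum-++ f xs ys)) (sym (+-assoc (f x) _ _))

  sum-map : ∀ {A B : Set} (f : B → ℚ) (g : A → B) xs → sumℚ (map f (map g xs)) ≡ sumℚ (map (f ∘ g) xs)
  sum-map f g []       = refl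
  sum-map f g (x ∷ xs) = cong (f (g x) +_) (sum-map f g xs)

  sum-concatMap : ∀ {A B : Set} (f : B → ℚ) (g : A → List B) xs →
                  sumℚ (map f (concatMap g xs)) ≡ sumℚ (map (λ x → sumℚ (map f (g x))) xs)
  sum-concatMap f g []       = refl
  sum-concatMap f g (x ∷ xs) = trans (sum-++ f (g x) (concatMap g xs)) (cong (sumℚ (map f (g x)) +_) (sum-concatMap f g xs))

  sum-members : ∀ {n} (E : Subset n) f → sumℚ (map f (members E)) ≡ sumIn E f
  sum-members {n} E f = begin
    sumℚ (map f (members E))                                           ≡⟨ sum-filter (_∈? E) f (List.allFin n) ⟩
    sumℚ (map (λ i → when (does (i ∈? E)) (f i)) (List.allFin n))      ≡⟨ tabulated (λ i → when (does (i ∈? E)) (f i)) id ⟩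
    sumIn ⊤ (λ i → when (does (i ∈? E)) (f i))                         ≡⟨ restricted E f ⟩
    sumIn E f                                                          ∎
    where
    open ≡-Reasoning
    tabulated : ∀ {A : Set} {m} (h : A → ℚ) (g : Fin m → A) → sumℚ (map h (List.tabulate g)) ≡ sumIn ⊤ (h ∘ g)
    tabulated {m = zero}  h g = refl
    tabulated {m = suc m} h g = cong (h (g zero) +_) (tabulated h (g ∘ suc))
    restricted : ∀ {m} (F : Subset m) h → sumIn ⊤ (λ i → when (does (i ∈? F)) (h i)) ≡ sumIn F h
    restricted []          h = refl
    restricted (true ∷ F)  h = cong (h zero +_) (restricted F (h ∘ suc))
    restricted (false ∷ F) h = trans (+-identityˡ _) (restricted F (h ∘ suc))

  sum-pairsOf : ∀ {n} (E : Subset n) (f : Fin n × Fin n → ℚ) →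
                sumℚ (map f (pairsOf E)) ≡ sumIn E (λ u → sumIn E (λ v → when (does (u Finₚ.<? v)) (f (u , v))))
  sum-pairsOf E f = begin
    sumℚ (map f (pairsOf E))
      ≡⟨ sum-concatMap f _ (members E) ⟩
    sumℚ (map (λ u → sumℚ (map f (map (u ,_) (filter (u Finₚ.<?_) (members E))))) (members E))
      ≡⟨ sum-members E _ ⟩
    sumIn E (λ u → sumℚ (map f (map (u ,_) (filter (u Finₚ.<?_) (members E)))))
      ≡⟨ sumIn-cong E (λ u _ → trans (sum-map f (u ,_) (filter (u Finₚ.<?_) (members E))) (trans (sum-filter (u Finₚ.<?_) _ (members E)) (sum-members E _))) ⟩
    sumIn E (λ u → sumIn E (λ v → when (does (u Finₚ.<? v)) (f (u , v))))
      ∎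
    where open ≡-Reasoning

  when-exactly-one : ∀ {A B : Set} (a? : Dec A) (b? : Dec B) q → ¬ (A × B) → A ⊎ B →
                     when (does a?) q + when (does b?) q ≡ q
  when-exactly-one (yes a) (yes b) q ¬ab _        = ⊥-elim (¬ab (a , b))
  when-exactly-one (yes a) (no ¬b) q _   _        = +-identityʳ q
  when-exactly-one (no ¬a) (yes b) q _   _        = +-identityˡ q
  when-exactly-one (no ¬a) (no ¬b) q _   (inj₁ a) = ⊥-elim (¬a a)
  when-exactly-one (no ¬a) (no ¬b) q _   (inj₂ b) = ⊥-elim (¬b b)

  when-no : ∀ {A : Set} (a? : Dec A) q → ¬ A → when (does a?) q ≡ 0ℚ
  when-no (yes a) q ¬a = ⊥-elim (¬a a)
  when-no (no _)  q ¬a = refl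

  when-< : ∀ {n} (u v : Fin n) q → u ≢ v → when (does (u Finₚ.<? v)) q + when (does (v Finₚ.<? u)) q ≡ q
  when-< u v q u≢v = when-exactly-one (u Finₚ.<? v) (v Finₚ.<? u) q (λ (u<v , v<u) → ℕₚ.<-asym u<v v<u) (compare (Finₚ.<-cmp u v))
    where
    compare : _ → u Fin.< v ⊎ v Fin.< u
    compare (tri< u<v _ _) = inj₁ u<v
    compare (tri≈ _ u≡v _) = ⊥-elim (u≢v u≡v)
    compare (tri> _ _ v<u) = inj₂ v<u

  when-irrefl : ∀ {n} (u : Fin n) q → when (does (u Finₚ.<? u)) q + when (does (u Finₚ.<? u)) q ≡ 0ℚ
  when-irrefl u q = cong₂ _+_ (when-no (u Finₚ.<? u) q (ℕₚ.<-irrefl refl)) (when-no (u Finₚ.<? u) q (ℕₚ.<-irrefl refl))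

  when-+ : ∀ b p q → when b (p + q) ≡ when b p + when b q
  when-+ true  p q = refl
  when-+ false p q = refl

  when-0 : ∀ b → when b 0ℚ ≡ 0ℚ
  when-0 true  = refl
  when-0 false = refl

  when-mono : ∀ b {p q} → p ≤ q → when b p ≤ when b q
  when-mono true  le = le
  when-mono false le = ≤-refl

  -- Each element of E occurs in exactly ∣ E ∣ − 1 pairs.
  sum-pairs-+ : ∀ {n} (E : Subset n) (h : Fin n → ℚ) →
                sumIn E (λ u → sumIn E (λ v → when (does (u Finₚ.<? v)) (h u + h v))) ≡ (ℕtoℚ ∣ E ∣ - 1ℚ) * sumIn E h
  sum-pairs-+ E h = begin
    sumIn E (λ u → sumIn E (λ v → lt u v (h u + h v)))
      ≡⟨ sumIn-cong E (λ u _ → trans (sumIn-cong E (λ v _ → when-+ (does (u Finₚ.<? v)) (h u) (h v))) (sumIn-+ E _ _)) ⟩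
    sumIn E (λ u → sumIn E (λ v → lt u v (h u)) + sumIn E (λ v → lt u v (h v)))
      ≡⟨ sumIn-+ E _ _ ⟩
    sumIn E (λ u → sumIn E (λ v → lt u v (h u))) + sumIn E (λ u → sumIn E (λ v → lt u v (h v)))
      ≡⟨ cong (sumIn E (λ u → sumIn E (λ v → lt u v (h u))) +_) (sumIn-swap E E (λ u v → lt u v (h v))) ⟩
    sumIn E (λ u → sumIn E (λ v → lt u v (h u))) + sumIn E (λ u → sumIn E (λ v → lt v u (h u)))
      ≡⟨ sumIn-+ E _ _ ⟨
    sumIn E (λ u → sumIn E (λ v → lt u v (h u)) + sumIn E (λ v → lt v u (h u)))
      ≡⟨ sumIn-cong E row ⟩
    sumIn E (λ u → (ℕtoℚ ∣ E ∣ - 1ℚ) * h u)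
      ≡⟨ sumIn-* E (ℕtoℚ ∣ E ∣ - 1ℚ) h ⟩
    (ℕtoℚ ∣ E ∣ - 1ℚ) * sumIn E h
      ∎
    where
    open ≡-Reasoning
    lt : Fin _ → Fin _ → ℚ → ℚ
    lt u v = when (does (u Finₚ.<? v))
    take-one : ∀ a r → 0ℚ + r ≡ (a + r) - a
    take-one = solve-∀ ℚ-ring
    factor : ∀ m c → m * c - c ≡ (m - 1ℚ) * c
    factor = solve-∀ ℚ-ring
    row : ∀ u → u ∈ E → sumIn E (λ v → lt u v (h u)) + sumIn E (λ v → lt v u (h u)) ≡ (ℕtoℚ ∣ E ∣ - 1ℚ) * h u
    row u u∈E = begin
      sumIn E (λ v → lt u v (h u)) + sumIn E (λ v → lt v u (h u))       ≡⟨ sumIn-+ E _ _ ⟨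
      sumIn E (λ v → lt u v (h u) + lt v u (h u))                       ≡⟨ sumIn-remove E _ u∈E ⟩
      lt u u (h u) + lt u u (h u) + sumIn (E ∖ u) (λ v → lt u v (h u) + lt v u (h u))
        ≡⟨ cong₂ _+_ (when-irrefl u (h u)) (sumIn-cong (E ∖ u) (λ v v∈ → when-< u v (h u) (x∈p∖y⇒x≢y E v∈ ∘ sym))) ⟩
      0ℚ + sumIn (E ∖ u) (λ _ → h u)                                    ≡⟨ take-one (h u) _ ⟩
      h u + sumIn (E ∖ u) (λ _ → h u) - h u                             ≡⟨ cong (_- h u) (sumIn-remove E (λ _ → h u) u∈E) ⟨
      sumIn E (λ _ → h u) - h u                                         ≡⟨ cong (_- h u) (sumIn-const E (h u)) ⟩
      ℕtoℚ ∣ E ∣ * h u - h u                                            ≡⟨ factor (ℕtoℚ ∣ E ∣) (h u) ⟩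
      (ℕtoℚ ∣ E ∣ - 1ℚ) * h u                                           ∎

  -- Sums over all subsets, and over classes of subsets with a common trace.

  ∑ : ∀ {n} → (Subset n → ℚ) → ℚ
  ∑ {zero}  f = f []
  ∑ {suc n} f = ∑ (f ∘ (true ∷_)) + ∑ (f ∘ (false ∷_))

  ∑-cong : ∀ {n} {f g : Subset n → ℚ} → (∀ E → f E ≡ g E) → ∑ f ≡ ∑ g
  ∑-cong {zero}  eq = eq []
  ∑-cong {suc n} eq = cong₂ _+_ (∑-cong (eq ∘ (true ∷_))) (∑-cong (eq ∘ (false ∷_)))

  ∑-mono : ∀ {n} {f g : Subset n → ℚ} → (∀ E → f E ≤ g E) → ∑ f ≤ ∑ g
  ∑-mono {zero}  le = le []
  ∑-mono {suc n} le = +-mono-≤ (∑-mono (le ∘ (true ∷_))) (∑-mono (le ∘ (false ∷_)))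

  ∑-0 : ∀ n → ∑ {n} (λ _ → 0ℚ) ≡ 0ℚ
  ∑-0 zero    = refl
  ∑-0 (suc n) = cong₂ _+_ (∑-0 n) (∑-0 n)

  0≤∑ : ∀ {n} {f : Subset n → ℚ} → (∀ E → 0ℚ ≤ f E) → 0ℚ ≤ ∑ f
  0≤∑ {n} {f} 0≤f = subst (_≤ ∑ f) (∑-0 n) (∑-mono 0≤f)

  ∑-+ : ∀ {n} (f g : Subset n → ℚ) → ∑ (λ E → f E + g E) ≡ ∑ f + ∑ g
  ∑-+ {zero}  f g = refl
  ∑-+ {suc n} f g =
    trans (cong₂ _+_ (∑-+ (f ∘ (true ∷_)) (g ∘ (true ∷_))) (∑-+ (f ∘ (false ∷_)) (g ∘ (false ∷_))))
          (+-interchange (∑ (f ∘ (true ∷_))) (∑ (g ∘ (true ∷_))) (∑ (f ∘ (false ∷_))) (∑ (g ∘ (false ∷_))))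

  ∑-* : ∀ {n} c (f : Subset n → ℚ) → ∑ (λ E → c * f E) ≡ c * ∑ f
  ∑-* {zero}  c f = refl
  ∑-* {suc n} c f = trans (cong₂ _+_ (∑-* c (f ∘ (true ∷_))) (∑-* c (f ∘ (false ∷_)))) (sym (*-distribˡ-+ c _ _))

  ∑-sumIn-swap : ∀ {m n} (S : Subset m) (f : Subset n → Fin m → ℚ) →
                 ∑ (λ E → sumIn S (f E)) ≡ sumIn S (λ j → ∑ (λ E → f E j))
  ∑-sumIn-swap {n = zero}  S f = refl
  ∑-sumIn-swap {n = suc n} S f =
    trans (cong₂ _+_ (∑-sumIn-swap S (f ∘ (true ∷_))) (∑-sumIn-swap S (f ∘ (false ∷_)))) (sym (sumIn-+ S _ _))

  sum-allSubsets : ∀ n (f : Subset n → ℚ) → sumℚ (map f (allSubsets n)) ≡ ∑ f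
  sum-allSubsets zero    f = +-identityʳ (f [])
  sum-allSubsets (suc n) f =
    trans (sum-++ f (map (true ∷_) (allSubsets n)) (map (false ∷_) (allSubsets n)))
          (cong₂ _+_ (trans (sum-map f (true ∷_) (allSubsets n)) (sum-allSubsets n (f ∘ (true ∷_))))
                     (trans (sum-map f (false ∷_) (allSubsets n)) (sum-allSubsets n (f ∘ (false ∷_)))))

  sum-kSubsets : ∀ n k (f : Subset n → ℚ) →
                 sumℚ (map f (kSubsets n k)) ≡ ∑ (λ E → when (does (∣ E ∣ ℕ.≟ k)) (f E))
  sum-kSubsets n k f = trans (sum-filter (λ E → ∣ E ∣ ℕ.≟ k) f (allSubsets n)) (sum-allSubsets n _)

  -- agree P G E: the sets G and E have the same elements outside P.
  agree : ∀ {n} → Subset n → Subset n → Subset n → Bool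
  agree []          []          []          = true
  agree (true ∷ P)  (_ ∷ G)     (_ ∷ E)     = agree P G E
  agree (false ∷ P) (true ∷ G)  (true ∷ E)  = agree P G E
  agree (false ∷ P) (true ∷ G)  (false ∷ E) = false
  agree (false ∷ P) (false ∷ G) (true ∷ E)  = false
  agree (false ∷ P) (false ∷ G) (false ∷ E) = agree P G E

  agree⇒⊆ : ∀ {n} (P G E : Subset n) → agree P G E ≡ true → ∀ {i} → i ∈ E → i ∉ P → i ∈ G
  agree⇒⊆ (true ∷ P)  (_ ∷ G)     (_ ∷ E)     eq here       i∉P = ⊥-elim (i∉P here)
  agree⇒⊆ (true ∷ P)  (_ ∷ G)     (_ ∷ E)     eq (there i∈) i∉P = there (agree⇒⊆ P G E eq i∈ (i∉P ∘ there))
  agree⇒⊆ (false ∷ P) (true ∷ G)  (true ∷ E)  eq here       i∉P = here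
  agree⇒⊆ (false ∷ P) (true ∷ G)  (true ∷ E)  eq (there i∈) i∉P = there (agree⇒⊆ P G E eq i∈ (i∉P ∘ there))
  agree⇒⊆ (false ∷ P) (true ∷ G)  (false ∷ E) ()
  agree⇒⊆ (false ∷ P) (false ∷ G) (true ∷ E)  ()
  agree⇒⊆ (false ∷ P) (false ∷ G) (false ∷ E) eq (there i∈) i∉P = there (agree⇒⊆ P G E eq i∈ (i∉P ∘ there))

  agree-sym : ∀ {n} (P G E : Subset n) → agree P G E ≡ agree P E G
  agree-sym []          []          []          = refl
  agree-sym (true ∷ P)  (_ ∷ G)     (_ ∷ E)     = agree-sym P G E
  agree-sym (false ∷ P) (true ∷ G)  (true ∷ E)  = agree-sym P G E
  agree-sym (false ∷ P) (true ∷ G)  (false ∷ E) = refl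
  agree-sym (false ∷ P) (false ∷ G) (true ∷ E)  = refl
  agree-sym (false ∷ P) (false ∷ G) (false ∷ E) = agree-sym P G E

  agree⇒⊇ : ∀ {n} (P G E : Subset n) → agree P G E ≡ true → ∀ {i} → i ∈ G → i ∉ P → i ∈ E
  agree⇒⊇ P G E eq = agree⇒⊆ P E G (trans (sym (agree-sym P G E)) eq)

  agree-intro : ∀ {n} (P G E : Subset n) → (∀ {i} → i ∈ E → i ∉ P → i ∈ G) → (∀ {i} → i ∈ G → i ∉ P → i ∈ E) →
                agree P G E ≡ true
  agree-intro []          []          []          f g = refl
  agree-intro (true ∷ P)  (_ ∷ G)     (_ ∷ E)     f g =
    agree-intro P G E (λ a b → drop-there (f (there a) (b ∘ drop-there))) (λ a b → drop-there (g (there a) (b ∘ drop-there)))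
  agree-intro (false ∷ P) (true ∷ G)  (true ∷ E)  f g =
    agree-intro P G E (λ a b → drop-there (f (there a) (b ∘ drop-there))) (λ a b → drop-there (g (there a) (b ∘ drop-there)))
  agree-intro (false ∷ P) (true ∷ G)  (false ∷ E) f g with () ← g here (λ ())
  agree-intro (false ∷ P) (false ∷ G) (true ∷ E)  f g with () ← f here (λ ())
  agree-intro (false ∷ P) (false ∷ G) (false ∷ E) f g =
    agree-intro P G E (λ a b → drop-there (f (there a) (b ∘ drop-there))) (λ a b → drop-there (g (there a) (b ∘ drop-there)))

  agree-inside : ∀ {n} (P G E : Subset n) → (∀ j → j ∈ G → j ∈ P) → agree P G E ≡ true → E ⊆ P
  agree-inside P G E G⊆P ag {i} i∈E = decidable-stable (i ∈? P) (λ i∉P → i∉P (G⊆P i (agree⇒⊆ P G E ag i∈E i∉P)))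

  -- Many `G` describe the same class, so summing the hypotheses over `G` would count classes
  -- repeatedly. The recursion avoids this: at an element of `P` the two branches are merged into
  -- one function, and one choice of the head of `G` serves for both; at an element outside `P` they
  -- belong to different classes and are bounded separately.
  ∑-by-classes : ∀ {n} (P : Subset n) (h : Subset n → ℚ) →
                 (∀ G → 0ℚ ≤ ∑ (λ E → when (agree P G E) (h E))) → 0ℚ ≤ ∑ h
  ∑-by-classes []          h class = class []
  ∑-by-classes (true ∷ P)  h class =
    subst (0ℚ ≤_) (∑-+ (h ∘ (true ∷_)) (h ∘ (false ∷_)))
      (∑-by-classes P (λ E → h (true ∷ E) + h (false ∷ E)) (λ G →
        subst (0ℚ ≤_) (sym (trans (∑-cong (λ E → when-+ (agree P G E) (h (true ∷ E)) (h (false ∷ E))))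
          (∑-+ (λ E → when (agree P G E) (h (true ∷ E))) (λ E → when (agree P G E) (h (false ∷ E))))))
          (class (true ∷ G))))
  ∑-by-classes {suc n} (false ∷ P) h class = 0≤p+q
    (∑-by-classes P (h ∘ (true ∷_)) (λ G → subst (0ℚ ≤_) (trans (cong (∑ (λ E → when (agree P G E) (h (true ∷ E))) +_) (∑-0 n)) (+-identityʳ _)) (class (true ∷ G))))
    (∑-by-classes P (h ∘ (false ∷_)) (λ G → subst (0ℚ ≤_) (trans (cong (_+ ∑ (λ E → when (agree P G E) (h (false ∷ E)))) (∑-0 n)) (+-identityˡ _)) (class (false ∷ G))))

  -- For `t` the indicator of size k this is a binomial coefficient. A general weight `t` is kept
  -- because removing an element from the sets shifts `t` to `t ∘ suc`.
  count : ∀ {n} → Subset n → Subset n → (ℕ → ℚ) → ℚ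
  count P G t = ∑ (λ E → when (agree P G E) (t ∣ E ∣))

  -- The weighted number of sets in the class of G that contain one given element of P; it does not depend on
  -- the element, which is what makes class averages equal to the average over P.
  coef : ∀ {n} → Subset n → Subset n → (ℕ → ℚ) → ℚ
  coef []          []          t = 0ℚ
  coef (true ∷ P)  (_ ∷ G)     t = count P G (t ∘ suc)
  coef (false ∷ P) (true ∷ G)  t = coef P G (t ∘ suc)
  coef (false ∷ P) (false ∷ G) t = coef P G t

  0≤when : ∀ b {q} → 0ℚ ≤ q → 0ℚ ≤ when b q
  0≤when true  0≤q = 0≤q
  0≤when false 0≤q = ≤-refl

  0≤coef : ∀ {n} (P G : Subset n) {t} → (∀ m → 0ℚ ≤ t m) → 0ℚ ≤ coef P G t
  0≤coef []          []          0≤t = ≤-refl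
  0≤coef (true ∷ P)  (_ ∷ G)     0≤t = 0≤∑ (λ E → 0≤when (agree P G E) (0≤t _))
  0≤coef (false ∷ P) (true ∷ G)  0≤t = 0≤coef P G (0≤t ∘ suc)
  0≤coef (false ∷ P) (false ∷ G) 0≤t = 0≤coef P G 0≤t

  count-in : ∀ {n} (P G : Subset n) t → count (false ∷ P) (true ∷ G) t ≡ count P G (t ∘ suc)
  count-in {n} P G t = trans (cong (count P G (t ∘ suc) +_) (∑-0 n)) (+-identityʳ _)

  count-out : ∀ {n} (P G : Subset n) t → count (false ∷ P) (false ∷ G) t ≡ count P G t
  count-out {n} P G t = trans (cong (_+ count P G t) (∑-0 n)) (+-identityˡ _)

  -- Pascal's rule; the factor sumIn P a disposes of the case P = ∅, where it fails.
  coef-pascal : ∀ {n} (P G : Subset n) t a → (coef P G (t ∘ suc) + coef P G t) * sumIn P a ≡ count P G (t ∘ suc) * sumIn P a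
  coef-pascal []          []          t a = trans (*-zeroʳ (0ℚ + 0ℚ)) (sym (*-zeroʳ (t 1)))
  coef-pascal (true ∷ P)  (_ ∷ G)     t a = refl
  coef-pascal (false ∷ P) (true ∷ G)  t a =
    trans (coef-pascal P G (t ∘ suc) (a ∘ suc)) (cong (_* sumIn P (a ∘ suc)) (sym (count-in P G (t ∘ suc))))
  coef-pascal (false ∷ P) (false ∷ G) t a =
    trans (coef-pascal P G t (a ∘ suc)) (cong (_* sumIn P (a ∘ suc)) (sym (count-out P G (t ∘ suc))))

  -- The traces on `P` of the members of a class run through all subsets of `P`, weighted by size
  -- only, so each element of `P` is counted equally often. In the induction the first element of
  -- `P` is counted `N` times by definition, while the tail is counted in the sets with and without
  -- that element; Pascal's rule makes these two counts add up to `N` as well.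
  class-average : ∀ {n} (P G : Subset n) t a →
                  ∑ (λ E → when (agree P G E) (t ∣ E ∣ * sumIn (E ∩ P) a)) ≡ coef P G t * sumIn P a
  class-average []          []          t a = trans (*-zeroʳ (t 0)) (sym (*-zeroˡ 0ℚ))
  class-average (true ∷ P)  (_ ∷ G)     t a = begin
    ∑ (λ E → when (agree P G E) (t (suc ∣ E ∣) * (a zero + A E))) + ∑ (λ E → when (agree P G E) (t ∣ E ∣ * A E))
      ≡⟨ cong₂ _+_ (trans (∑-cong (λ E → expand (agree P G E) (t (suc ∣ E ∣)) (a zero) (A E)))
                          (∑-+ (λ E → a zero * when (agree P G E) (t (suc ∣ E ∣))) (λ E → when (agree P G E) (t (suc ∣ E ∣) * A E))))
                   (class-average P G t (a ∘ suc)) ⟩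
    ∑ (λ E → a zero * when (agree P G E) (t (suc ∣ E ∣))) + ∑ (λ E → when (agree P G E) (t (suc ∣ E ∣) * A E)) + coef P G t * ΣA
      ≡⟨ cong (_+ coef P G t * ΣA) (cong₂ _+_ (∑-* (a zero) (λ E → when (agree P G E) (t (suc ∣ E ∣)))) (class-average P G (t ∘ suc) (a ∘ suc))) ⟩
    a zero * N + coef P G (t ∘ suc) * ΣA + coef P G t * ΣA
      ≡⟨ collect (a zero * N) (coef P G (t ∘ suc)) (coef P G t) ΣA ⟩
    a zero * N + (coef P G (t ∘ suc) + coef P G t) * ΣA
      ≡⟨ cong (a zero * N +_) (coef-pascal P G t (a ∘ suc)) ⟩
    a zero * N + N * ΣA
      ≡⟨ factor (a zero) N ΣA ⟩
    N * (a zero + ΣA)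
      ∎
    where
    open ≡-Reasoning
    A : Subset _ → ℚ
    A E = sumIn (E ∩ P) (a ∘ suc)
    ΣA = sumIn P (a ∘ suc)
    N = count P G (t ∘ suc)
    expand : ∀ b c p q → when b (c * (p + q)) ≡ p * when b c + when b (c * q)
    expand true  c p q = trans (*-distribˡ-+ c p q) (cong (_+ c * q) (*-comm c p))
    expand false c p q = sym (trans (+-identityʳ (p * 0ℚ)) (*-zeroʳ p))
    collect : ∀ p b c q → p + b * q + c * q ≡ p + (b + c) * q
    collect = solve-∀ ℚ-ring
    factor : ∀ a n q → a * n + n * q ≡ n * (a + q)
    factor = solve-∀ ℚ-ring
  class-average {suc n} (false ∷ P) (true ∷ G)  t a =
    trans (cong (∑ (λ E → when (agree P G E) (t (suc ∣ E ∣) * sumIn (E ∩ P) (a ∘ suc))) +_) (∑-0 n))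
          (trans (+-identityʳ _) (class-average P G (t ∘ suc) (a ∘ suc)))
  class-average {suc n} (false ∷ P) (false ∷ G) t a =
    trans (cong (_+ ∑ (λ E → when (agree P G E) (t ∣ E ∣ * sumIn (E ∩ P) (a ∘ suc)))) (∑-0 n))
          (trans (+-identityˡ _) (class-average P G t (a ∘ suc)))

  -- Pairs inside a set and the labels of their nodes.

  ∈-members⁺ : ∀ {n} {E : Subset n} {i} → i ∈ E → i ∈ₗ members E
  ∈-members⁺ {E = E} {i} i∈E = ∈-filter⁺ (_∈? E) (∈-allFin i) i∈E

  ∈-members⁻ : ∀ {n} {E : Subset n} {i} → i ∈ₗ members E → i ∈ E
  ∈-members⁻ {E = E} i∈ = proj₂ (∈-filter⁻ (_∈? E) {xs = List.allFin _} i∈)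

  ∈-pairsOf⁺ : ∀ {n} {E : Subset n} {u v} → u ∈ E → v ∈ E → u Fin.< v → (u , v) ∈ₗ pairsOf E
  ∈-pairsOf⁺ {E = E} {u} {v} u∈E v∈E u<v =
    ∈-concatMap⁺ _ (Any.map (λ { refl → ∈-map⁺ (u ,_) (∈-filter⁺ (u Finₚ.<?_) (∈-members⁺ v∈E) u<v) }) (∈-members⁺ u∈E))

  ∈-pairsOf⁻ : ∀ {n} {E : Subset n} {u v} → (u , v) ∈ₗ pairsOf E → u ∈ E × v ∈ E
  ∈-pairsOf⁻ {E = E} {u} {v} uv∈ = find (∈-members⁻ {E = E}) (∈-concatMap⁻ (λ w → map (w ,_) (filter (w Finₚ.<?_) (members E))) uv∈)
    where
    find : ∀ {ws} → (∀ {w} → w ∈ₗ ws → w ∈ E) →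
           Any.Any (λ w → (u , v) ∈ₗ map (w ,_) (filter (w Finₚ.<?_) (members E))) ws → u ∈ E × v ∈ E
    find sub (here uv∈) with ∈-map⁻ _ uv∈
    ... | _ , v∈ , refl = sub (here refl) , ∈-members⁻ (proj₁ (∈-filter⁻ (_ Finₚ.<?_) v∈))
    find sub (there uv∈) = find (sub ∘ there) uv∈

  all-true : ∀ {A : Set} (p : A → Bool) {xs x} → all p xs ≡ true → x ∈ₗ xs → p x ≡ true
  all-true p {y ∷ xs} eq x∈ with p y in py
  all-true p {y ∷ xs} eq (here refl) | true = py
  all-true p {y ∷ xs} eq (there x∈)  | true = all-true p eq x∈

  all-false : ∀ {A : Set} (p : A → Bool) xs → all p xs ≡ false → ∃ λ x → x ∈ₗ xs × p x ≡ false
  all-false p (y ∷ xs) eq with p y in py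
  ... | false = y , here refl , py
  ... | true  with all-false p xs eq
  ...   | x , x∈ , px = x , there x∈ , px

  uncutLabel-true : ∀ {n} (c : Fin n → ℕ) (E : Subset n) → uncutLabel c E ≡ true → ∀ {u v} → u ∈ E → v ∈ E → c u ≡ c v
  uncutLabel-true c E eq {u} {v} u∈E v∈E with Finₚ.<-cmp u v
  ... | tri≈ _ refl _ = refl
  ... | tri< u<v _ _ with c u ℕ.≟ c v | all-true _ eq (∈-pairsOf⁺ {E = E} u∈E v∈E u<v)
  ...   | yes cu≡cv | _ = cu≡cv
  uncutLabel-true c E eq {u} {v} u∈E v∈E | tri> _ _ v<u with c v ℕ.≟ c u | all-true _ eq (∈-pairsOf⁺ {E = E} v∈E u∈E v<u)
  ...   | yes cv≡cu | _ = sym cv≡cu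

  uncutLabel-false : ∀ {n} (c : Fin n → ℕ) (E : Subset n) → uncutLabel c E ≡ false →
                     ∃ λ u → ∃ λ v → u ∈ E × v ∈ E × c u ≢ c v
  uncutLabel-false c E eq with all-false _ (pairsOf E) eq
  ... | (u , v) , uv∈ , cu≢cv with c u ℕ.≟ c v
  ...   | no ¬p = u , v , proj₁ (∈-pairsOf⁻ {E = E} uv∈) , proj₂ (∈-pairsOf⁻ {E = E} uv∈) , ¬p

  p+p≤q+q⇒p≤q : ∀ {p q} → p + p ≤ q + q → p ≤ q
  p+p≤q+q⇒p≤q {p} {q} le with p ≤? q
  ... | yes p≤q = p≤q
  ... | no  p≰q = ⊥-elim (<-irrefl refl (<-≤-trans (+-mono-< (≰⇒> p≰q) (≰⇒> p≰q)) le))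

  -- Exchanging the summation order turns the second copy of `Q` into the sum over u > v, and the
  -- diagonal contributes nothing.
  sum-pairs-symmetric : ∀ {n} (E : Subset n) (f : Fin n → Fin n → ℚ) → (∀ u v → f u v ≡ f v u) → (∀ u → f u u ≡ 0ℚ) →
    let Q = sumIn E (λ u → sumIn E (λ v → when (does (u Finₚ.<? v)) (f u v)))
    in Q + Q ≡ sumIn E (λ u → sumIn E (f u))
  sum-pairs-symmetric E f symm diag = begin
    Q + Q
      ≡⟨ cong (Q +_) (sumIn-swap E E (λ u v → when (does (u Finₚ.<? v)) (f u v))) ⟩
    Q + sumIn E (λ u → sumIn E (λ v → when (does (v Finₚ.<? u)) (f v u)))
      ≡⟨ sumIn-+ E _ _ ⟨
    sumIn E (λ u → sumIn E (λ v → when (does (u Finₚ.<? v)) (f u v)) + sumIn E (λ v → when (does (v Finₚ.<? u)) (f v u)))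
      ≡⟨ sumIn-cong E (λ u _ → trans (sym (sumIn-+ E _ _)) (sumIn-cong E (λ v _ → entry u v))) ⟩
    sumIn E (λ u → sumIn E (f u))
      ∎
    where
    open ≡-Reasoning
    Q = sumIn E (λ u → sumIn E (λ v → when (does (u Finₚ.<? v)) (f u v)))
    entry : ∀ u v → when (does (u Finₚ.<? v)) (f u v) + when (does (v Finₚ.<? u)) (f v u) ≡ f u v
    entry u v rewrite symm v u with u Finₚ.≟ v
    ... | yes refl = trans (when-irrefl u (f u u)) (sym (diag u))
    ... | no  u≢v  = when-< u v (f u v) u≢v


  -- A labelling as an integral LP solution.

  separation : ∀ {A : Set} → Dec A → ℚ
  separation a? = if does a? then 0ℚ else 1ℚ

  separation-yes : ∀ {A : Set} (a? : Dec A) → A → separation a? ≡ 0ℚ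
  separation-yes (yes _) a = refl
  separation-yes (no ¬a) a = ⊥-elim (¬a a)

  separation-no : ∀ {A : Set} (a? : Dec A) → ¬ A → separation a? ≡ 1ℚ
  separation-no (yes a) ¬a = ⊥-elim (¬a a)
  separation-no (no _)  ¬a = refl

  0≤separation : ∀ {A : Set} (a? : Dec A) → 0ℚ ≤ separation a?
  0≤separation (yes _) = ≤-refl
  0≤separation (no _)  = 0≤1

  separation≤1 : ∀ {A : Set} (a? : Dec A) → separation a? ≤ 1ℚ
  separation≤1 (yes _) = 0≤1
  separation≤1 (no _)  = ≤-refl

  1≤p+q : ∀ {p q} → 1ℚ ≤ p → 0ℚ ≤ q → 1ℚ ≤ p + q
  1≤p+q {p} {q} 1≤p 0≤q = subst (_≤ p + q) (+-identityʳ 1ℚ) (+-mono-≤ 1≤p 0≤q)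

  separation-trichotomy : ∀ {A B C : Set} (a? : Dec A) (b? : Dec B) (c? : Dec C) → (B → C → A) →
                          separation a? ≤ separation b? + separation c?
  separation-trichotomy a?      (yes b) (yes c) f = ≤-reflexive (separation-yes a? (f b c))
  separation-trichotomy a?      (yes b) (no ¬c) f = separation≤1 a?
  separation-trichotomy a?      (no ¬b) c?      f = ≤-trans (separation≤1 a?) (1≤p+q ≤-refl (0≤separation c?))

  module Labelling {n : ℕ} (c : Fin n → ℕ) where

    dist : Fin n → Fin n → ℚ
    dist u v = separation (c u ℕ.≟ c v)

    distE : Subset n → ℚ
    distE E = if uncutLabel c E then 0ℚ else 1ℚ

    dist-sym : ∀ u v → dist u v ≡ dist v u
    dist-sym u v with c u ℕₚ.≟ c v
    ... | yes eq = trans (separation-yes (c u ℕ.≟ c v) eq) (sym (separation-yes (c v ℕ.≟ c u) (sym eq)))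
    ... | no neq = trans (separation-no (c u ℕ.≟ c v) neq) (sym (separation-no (c v ℕ.≟ c u) (neq ∘ sym)))

    dist-diag : ∀ u → dist u u ≡ 0ℚ
    dist-diag u = separation-yes (c u ℕ.≟ c u) refl

    dist-tri : ∀ u v w → dist u v ≤ dist u w + dist v w
    dist-tri u v w = separation-trichotomy (c u ℕ.≟ c v) (c u ℕ.≟ c w) (c v ℕ.≟ c w) (λ uw vw → trans uw (sym vw))

    0≤distE : ∀ E → 0ℚ ≤ distE E
    0≤distE E with uncutLabel c E
    ... | true  = ≤-refl
    ... | false = 0≤1

    distE≤1 : ∀ E → distE E ≤ 1ℚ
    distE≤1 E with uncutLabel c E
    ... | true  = 0≤1
    ... | false = ≤-refl

    dist≤distE : ∀ E {u v} → u ∈ E → v ∈ E → dist u v ≤ distE E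
    dist≤distE E {u} {v} u∈E v∈E with uncutLabel c E in eq
    ... | true  = ≤-reflexive (separation-yes (c u ℕ.≟ c v) (uncutLabel-true c E eq u∈E v∈E))
    ... | false = separation≤1 (c u ℕ.≟ c v)

    -- If p, q ∈ E have different labels, every element of E is separated from p or from q: the rows of p and q
    -- sum to at least ∣ E ∣, and every row is at least 1.
    separated-pairs : ∀ (E : Subset n) {p q} → p ∈ E → q ∈ E → c p ≢ c q →
                      ℕtoℚ ∣ E ∣ - 1ℚ ≤ sumℚ (map (λ (u , v) → dist u v) (pairsOf E))
    separated-pairs E {p} {q} p∈E q∈E cp≢cq =
      subst (κ - 1ℚ ≤_) (sym (sum-pairsOf E (λ (u , v) → dist u v)))
        (p+p≤q+q⇒p≤q (subst (κ - 1ℚ + (κ - 1ℚ) ≤_) (sym (sum-pairs-symmetric E dist dist-sym dist-diag))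
          (≤-trans (≤-reflexive (double κ)) (≤-trans (+-monoʳ-≤ κ rows-2) (≤-reflexive rows)))))
      where
      κ = ℕtoℚ ∣ E ∣
      row : Fin n → ℚ
      row u = sumIn E (dist u)
      p≢q : p ≢ q
      p≢q refl = cp≢cq refl
      pq-apart : ∀ v → 1ℚ ≤ dist p v + dist q v
      pq-apart v = ≤-trans (≤-reflexive (sym (separation-no (c p ℕ.≟ c q) cp≢cq))) (dist-tri p q v)
      row≥1 : ∀ u → 1ℚ ≤ row u
      row≥1 u = ≤-trans (pq-apart u) (≤-trans (≤-reflexive (cong₂ _+_ (dist-sym p u) (dist-sym q u)))
        (two-terms≤sumIn E (dist u) p∈E q∈E p≢q (λ i _ → 0≤separation (c u ℕ.≟ c i))))
      row-pq : κ ≤ row p + row q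
      row-pq = subst₂ _≤_ (trans (sumIn-const E 1ℚ) (*-identityʳ κ)) (sumIn-+ E (dist p) (dist q)) (sumIn-mono E (λ v _ → pq-apart v))
      double : ∀ κ → κ - 1ℚ + (κ - 1ℚ) ≡ κ + (κ - 2ℚ)
      double = solve-∀ ℚ-ring
      shift : ∀ a b → (a - 1ℚ) + (b - 1ℚ) ≡ a + b - 2ℚ
      shift = solve-∀ ℚ-ring
      rows-2 : κ - 2ℚ ≤ sumIn E (λ u → row u - 1ℚ)
      rows-2 = ≤-trans (≤-trans (+-monoˡ-≤ (- 2ℚ) row-pq) (≤-reflexive (sym (shift (row p) (row q)))))
        (two-terms≤sumIn E (λ u → row u - 1ℚ) p∈E q∈E p≢q (λ u _ → p≤q⇒0≤q-p (row≥1 u)))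
      cancel : ∀ κ r → κ + (r - κ) ≡ r
      cancel = solve-∀ ℚ-ring
      rows : κ + sumIn E (λ u → row u - 1ℚ) ≡ sumIn E row
      rows = trans (cong (κ +_) (sumIn--1 E row)) (cancel κ (sumIn E row))

    feasible : ∀ K → LPFeasible n (suc K) dist distE
    feasible K = record
      { symm   = dist-sym
      ; diag   = dist-diag
      ; tri    = λ u v w _ _ _ → dist-tri u v w
      ; x-lo   = λ u v → 0≤separation (c u ℕ.≟ c v)
      ; x-hi   = λ u v → separation≤1 (c u ℕ.≟ c v)
      ; edge   = λ E _ u v u∈E v∈E _ → dist≤distE E u∈E v∈E
      ; sumcon = sumcon
      ; xE-lo  = λ E _ → 0≤distE E
      ; xE-hi  = λ E _ → distE≤1 E
      }
      where
      pred : ∀ m → 1ℚ + m - 1ℚ ≡ m * 1ℚ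
      pred = solve-∀ ℚ-ring
      sumcon : ∀ E → ∣ E ∣ ≡ suc K → ℕtoℚ K * distE E ≤ sumℚ (map (λ (u , v) → dist u v) (pairsOf E))
      sumcon E ∣E∣ with uncutLabel c E in eq
      ... | true  = ≤-trans (≤-reflexive (*-zeroʳ (ℕtoℚ K)))
          (subst (0ℚ ≤_) (sym (sum-pairsOf E (λ (u , v) → dist u v)))
            (0≤sumIn E (λ u _ → 0≤sumIn E (λ v _ → 0≤when (does (u Finₚ.<? v)) (0≤separation (c u ℕ.≟ c v))))))
      ... | false with uncutLabel-false c E eq
      ...   | p , q , p∈E , q∈E , cp≢cq =
        subst (_≤ _) (trans (cong (_- 1ℚ) (trans (cong ℕtoℚ ∣E∣) (ℕtoℚ-suc K))) (pred (ℕtoℚ K))) (separated-pairs E p∈E q∈E cp≢cq)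

    LPobj-labelling : ∀ k w⁺ w⁻ → LPobj n k w⁺ w⁻ distE ≡ cost n k w⁺ w⁻ (uncutLabel c)
    LPobj-labelling k w⁺ w⁻ = cong sumℚ (map-cong term (kSubsets n k))
      where
      kept : ∀ p q → p * 0ℚ + q * (1ℚ - 0ℚ) ≡ q
      kept = solve-∀ ℚ-ring
      cut : ∀ p q → p * 1ℚ + q * (1ℚ - 1ℚ) ≡ p
      cut = solve-∀ ℚ-ring
      term : ∀ E → w⁺ E * distE E + w⁻ E * (1ℚ - distE E) ≡ (if uncutLabel c E then w⁻ E else w⁺ E)
      term E with uncutLabel c E
      ... | true  = kept (w⁺ E) (w⁻ E)
      ... | false = cut (w⁺ E) (w⁻ E)

  -- Nonnegativity of a class sum.

  ≤-when : ∀ {A : Set} (a? : Dec A) {c q} → (A → c ≤ q) → (¬ A → c ≤ 0ℚ) → c ≤ when (does a?) q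
  ≤-when (yes a) f g = f a
  ≤-when (no ¬a) f g = g ¬a

  when-≤-when : ∀ b {p q} → (b ≡ true → p ≤ q) → when b p ≤ when b q
  when-≤-when true  f = f refl
  when-≤-when false f = ≤-refl

  when-* : ∀ b p q → when b p * q ≡ when b (p * q)
  when-* true  p q = refl
  when-* false p q = *-zeroˡ q

  agree-─ : ∀ {n} (P G E : Subset n) → agree P G E ≡ true → E ─ P ≡ G ─ P
  agree-─ []          []          []          eq = refl
  agree-─ (true ∷ P)  (_ ∷ G)     (_ ∷ E)     eq = cong (false ∷_) (agree-─ P G E eq)
  agree-─ (false ∷ P) (true ∷ G)  (true ∷ E)  eq = cong (true ∷_) (agree-─ P G E eq)
  agree-─ (false ∷ P) (false ∷ G) (false ∷ E) eq = cong (false ∷_) (agree-─ P G E eq)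

  ∣p∣≡∣p∩q∣+∣p─q∣ : ∀ {n} (p q : Subset n) → ∣ p ∣ ≡ ∣ p ∩ q ∣ ℕ.+ ∣ p ─ q ∣
  ∣p∣≡∣p∩q∣+∣p─q∣ []          []          = refl
  ∣p∣≡∣p∩q∣+∣p─q∣ (true ∷ p)  (true ∷ q)  = cong suc (∣p∣≡∣p∩q∣+∣p─q∣ p q)
  ∣p∣≡∣p∩q∣+∣p─q∣ (true ∷ p)  (false ∷ q) = trans (cong suc (∣p∣≡∣p∩q∣+∣p─q∣ p q)) (sym (ℕₚ.+-suc ∣ p ∩ q ∣ ∣ p ─ q ∣))
  ∣p∣≡∣p∩q∣+∣p─q∣ (false ∷ p) (true ∷ q)  = ∣p∣≡∣p∩q∣+∣p─q∣ p q
  ∣p∣≡∣p∩q∣+∣p─q∣ (false ∷ p) (false ∷ q) = ∣p∣≡∣p∩q∣+∣p─q∣ p q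

  ∣p∣≡0⇒∉ : ∀ {n} (p : Subset n) {i} → ∣ p ∣ ≡ 0 → i ∉ p
  ∣p∣≡0⇒∉ (false ∷ p) eq (there i∈) = ∣p∣≡0⇒∉ p eq i∈

  ∣p∣≡suc⇒∈ : ∀ {n} (p : Subset n) {m} → ∣ p ∣ ≡ suc m → ∃ λ i → i ∈ p × ∣ p ∖ i ∣ ≡ m
  ∣p∣≡suc⇒∈ (true ∷ p)  eq = zero , here , trans (cong ∣_∣ (p─⊥≡p p)) (ℕₚ.suc-injective eq)
  ∣p∣≡suc⇒∈ (false ∷ p) eq with ∣p∣≡suc⇒∈ p eq
  ... | i , i∈p , eq′ = suc i , there i∈p , eq′

  -- The factor `μ` has to be the same for the whole class: only then does the sum of the lower
  -- bounds become a nonnegative multiple of `sumIn P a`, by `class-average` with weight `μ` at size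
  -- k and 0 at other sizes.
  class-bound : ∀ {n} (P G : Subset n) k (h : Subset n → ℚ) μ a → 0ℚ ≤ μ → 0ℚ ≤ sumIn P a →
                (∀ E → agree P G E ≡ true → ∣ E ∣ ≡ k → μ * sumIn (E ∩ P) a ≤ h E) →
                0ℚ ≤ ∑ (λ E → when (agree P G E) (when (does (∣ E ∣ ℕ.≟ k)) (h E)))
  class-bound P G k h μ a 0≤μ 0≤a bound = ≤-trans
    (subst (0ℚ ≤_) (sym (class-average P G t a)) (0≤p*q (0≤coef P G (λ m → 0≤when (does (m ℕ.≟ k)) 0≤μ)) 0≤a))
    (∑-mono (λ E → when-≤-when (agree P G E) (λ eq →
      subst (_≤ when (does (∣ E ∣ ℕ.≟ k)) (h E)) (sym (when-* (does (∣ E ∣ ℕ.≟ k)) μ _)) (pointwise E eq (∣ E ∣ ℕ.≟ k)))))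
    where
    t : ℕ → ℚ
    t m = when (does (m ℕ.≟ k)) μ
    pointwise : ∀ E → agree P G E ≡ true → (d : Dec (∣ E ∣ ≡ k)) → when (does d) (μ * sumIn (E ∩ P) a) ≤ when (does d) (h E)
    pointwise E eq (yes ∣E∣) = bound E eq ∣E∣
    pointwise E eq (no _)    = ≤-refl

  class-pointwise : ∀ {n} (P G : Subset n) k (h : Subset n → ℚ) → (∀ E → agree P G E ≡ true → ∣ E ∣ ≡ k → 0ℚ ≤ h E) →
                    0ℚ ≤ ∑ (λ E → when (agree P G E) (when (does (∣ E ∣ ℕ.≟ k)) (h E)))
  class-pointwise P G k h bound = 0≤∑ (λ E → 0≤-class E (agree P G E) refl)
    where
    0≤-class : ∀ E b → agree P G E ≡ b → 0ℚ ≤ when b (when (does (∣ E ∣ ℕ.≟ k)) (h E))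
    0≤-class E true  eq = ≤-when (∣ E ∣ ℕ.≟ k) (bound E eq) (λ _ → ≤-refl)
    0≤-class E false eq = ≤-refl

  *-cancel-inverse : ∀ {f μ p} → f * μ ≡ 1ℚ → μ * (f * p) ≡ p
  *-cancel-inverse {f} {μ} {p} fμ≡1 = trans (assoc f μ p) (trans (cong (_* p) fμ≡1) (*-identityˡ p))
    where
    assoc : ∀ f μ p → μ * (f * p) ≡ f * μ * p
    assoc = solve-∀ ℚ-ring

  -- Averages are bounded after multiplication by the number `f` of their terms, which keeps the
  -- certificates polynomial; the factor `μ = 1/f` is restored here.
  ≤-scale : ∀ {f μ p q} → 0ℚ ≤ μ → f * μ ≡ 1ℚ → q ≤ f * p → μ * q ≤ p
  ≤-scale {f} 0≤μ fμ≡1 le = ≤-trans (*-mono-≤ˡ 0≤μ le) (≤-reflexive (*-cancel-inverse {f} fμ≡1))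

  ≡true⇒≤ : ∀ {p q} → (p ≤ᵇ q) ≡ true → p ≤ q
  ≡true⇒≤ eq = ≤ᵇ⇒≤ (subst Bool.T (sym eq) tt)

  ≤⇒≡true : ∀ {p q} → p ≤ q → (p ≤ᵇ q) ≡ true
  ≤⇒≡true {p} {q} le with p ≤ᵇ q | ≤⇒≤ᵇ le
  ... | true | _ = refl

  ∧-trueˡ : ∀ {a b} → a ∧ b ≡ true → a ≡ true
  ∧-trueˡ {true} eq = refl

  ∧-trueʳ : ∀ {a b} → a ∧ b ≡ true → b ≡ true
  ∧-trueʳ {true} eq = eq

  -- The sets formed by one step of the algorithm.

  module _ {n : ℕ} (γ : ℚ) (x : Fin n → Fin n → ℚ) (W : Subset n) (u : Fin n) where

    private
      lookup-Tset : ∀ i → Vec.lookup (Tset γ x W u) i ≡ Vec.lookup W i ∧ not ⌊ i Finₚ.≟ u ⌋ ∧ (x u i ≤ᵇ γ)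
      lookup-Tset i = lookup∘tabulate _ i

    Tset⁻ : ∀ {i} → i ∈ Tset γ x W u → i ∈ W × i ≢ u × x u i ≤ γ
    Tset⁻ {i} i∈ = lookup⇒[]= i W (∧-trueˡ eq) , distinct , ≡true⇒≤ (∧-trueʳ {not ⌊ i Finₚ.≟ u ⌋} (∧-trueʳ {Vec.lookup W i} eq))
      where
      eq = trans (sym (lookup-Tset i)) ([]=⇒lookup i∈)
      distinct : i ≢ u
      distinct i≡u with i Finₚ.≟ u | ∧-trueˡ {not ⌊ i Finₚ.≟ u ⌋} (∧-trueʳ {Vec.lookup W i} eq)
      ... | no i≢u | _ = i≢u i≡u

    Tset⁺ : ∀ {i} → i ∈ W → i ≢ u → x u i ≤ γ → i ∈ Tset γ x W u
    Tset⁺ {i} i∈W i≢u le = lookup⇒[]= i (Tset γ x W u) (trans (lookup-Tset i)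
      (cong₂ _∧_ ([]=⇒lookup i∈W) (cong₂ _∧_ distinct (≤⇒≡true le))))
      where
      distinct : not ⌊ i Finₚ.≟ u ⌋ ≡ true
      distinct with i Finₚ.≟ u
      ... | yes i≡u = ⊥-elim (i≢u i≡u)
      ... | no  _   = refl

    clusterOf⊆W : ∀ δ → u ∈ W → clusterOf γ δ x W u ⊆ W
    clusterOf⊆W δ u∈W = either (sumℚ (map (x u) (members T)) <ᵇ (γ * δ * ℕtoℚ ∣ T ∣))
      where
      T = Tset γ x W u
      u⊆W : ⁅ u ⁆ ⊆ W
      u⊆W i∈u = subst (_∈ W) (sym (x∈⁅y⁆⇒x≡y u i∈u)) u∈W
      either : ∀ b → (if b then ⁅ u ⁆ ∪ T else ⁅ u ⁆) ⊆ W
      either false i∈ = u⊆W i∈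
      either true  i∈ = [ u⊆W , (λ i∈T → proj₁ (Tset⁻ i∈T)) ]′ (x∈p∪q⁻ ⁅ u ⁆ T i∈)

  uncut-∷ : ∀ {n} (S : Subset n) Ss E → uncutClusters (S ∷ Ss) E ≡ true → E ⊆ S ⊎ uncutClusters Ss E ≡ true
  uncut-∷ S Ss E eq with E ⊆? S
  ... | yes E⊆S = inj₁ E⊆S
  ... | no  _   = inj₂ eq

  -- Later clusters lie in what is left of `W`. Hence a set that meets the current cluster without
  -- being contained in it stays cut, and its payment is settled at once.
  uncut⇒⊆ : ∀ {n γ δ x} {W : Subset n} {Ss} → CGWRun γ δ x W Ss → ∀ E → uncutClusters Ss E ≡ true → E ⊆ W
  uncut⇒⊆ {γ = γ} {δ} {x} (step {W} {Ss} u u∈W run) E eq i∈E =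
    [ (λ E⊆S → clusterOf⊆W γ x W u δ u∈W (E⊆S i∈E))
    , (λ eq′ → p─q⊆p W (clusterOf γ δ x W u) (uncut⇒⊆ run E eq′ i∈E))
    ]′ (uncut-∷ (clusterOf γ δ x W u) Ss E eq)

  -- Distances, payments and slack for a feasible LP solution.

  module Rounding {n : ℕ} (k′ : ℕ) (w⁺ w⁻ : Subset n → ℚ)
    (0≤w⁺ : ∀ E → ∣ E ∣ ≡ suc (suc k′) → 0ℚ ≤ w⁺ E)
    (0≤w⁻ : ∀ E → ∣ E ∣ ≡ suc (suc k′) → 0ℚ ≤ w⁻ E)
    (w-sum : ∀ E → ∣ E ∣ ≡ suc (suc k′) → w⁺ E + w⁻ E ≡ 1ℚ)
    (x : Fin n → Fin n → ℚ) (xE : Subset n → ℚ) (feas : LPFeasible n (suc (suc k′)) x xE) where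

    open LPFeasible feas

    K k : ℕ
    K = suc k′
    k = suc K

    -- Abstract, so that with-abstraction does not normalise these fractions.
    abstract
      κ M : ℚ
      κ = ℕtoℚ K
      M = ℕtoℚ (4 ℕ.* K)

      κ-def : κ ≡ ℕtoℚ K
      κ-def = refl

      M-def : M ≡ ℕtoℚ (4 ℕ.* K)
      M-def = refl

    1≤κ : 1ℚ ≤ κ
    1≤κ = subst (1ℚ ≤_) (sym κ-def) (1≤ℕtoℚ-suc k′)

    0≤κ : 0ℚ ≤ κ
    0≤κ = ≤-trans 0≤1 1≤κ

    κ*invK : κ * invℕ K ≡ 1ℚ
    κ*invK = trans (cong (_* invℕ K) κ-def) (ℕtoℚ*invℕ k′)

    ℕtoℚ-k : ∀ {m} → m ≡ k → ℕtoℚ m ≡ 1ℚ + κ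
    ℕtoℚ-k refl = trans (ℕtoℚ-suc K) (cong (1ℚ +_) (sym κ-def))

    ℕtoℚ-2K : ℕtoℚ (2 ℕ.* K) ≡ κ + κ
    ℕtoℚ-2K = trans (cong (λ m → ℕtoℚ (K ℕ.+ m)) (ℕₚ.+-identityʳ K)) (trans (ℕtoℚ-+ K K) (cong₂ _+_ (sym κ-def) (sym κ-def)))

    M≡4κ : M ≡ 4ℚ * κ
    M≡4κ = trans (trans M-def (cong ℕtoℚ (ℕₚ.*-distribʳ-+ K 2 2)))
      (trans (ℕtoℚ-+ (2 ℕ.* K) (2 ℕ.* K)) (trans (cong₂ _+_ ℕtoℚ-2K ℕtoℚ-2K) (collect κ)))
      where
      collect : ∀ κ → κ + κ + (κ + κ) ≡ 4ℚ * κ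
      collect = solve-∀ ℚ-ring

    0≤M : 0ℚ ≤ M
    0≤M = subst (0ℚ ≤_) (sym M-def) (0≤ℕtoℚ (4 ℕ.* K))

    d : Fin n → Fin n → ℚ
    d u i = M * x u i

    D : Subset n → ℚ
    D E = M * xE E

    d-diag : ∀ u → d u u ≡ 0ℚ
    d-diag u = trans (cong (M *_) (diag u)) (*-zeroʳ M)

    -- The LP imposes the inequality on distinct nodes only; coinciding nodes are covered by `diag`,
    -- `symm` and `x-lo`.
    triangle : ∀ u a b → x a b ≤ x u a + x u b
    triangle u a b with a Finₚ.≟ b | u Finₚ.≟ a | u Finₚ.≟ b
    ... | yes refl | _ | _ = subst (_≤ x u a + x u a) (sym (diag a)) (0≤p+q (x-lo u a) (x-lo u a))
    ... | no _ | yes refl | _ = ≤-reflexive (sym (trans (cong (_+ x a b) (diag a)) (+-identityˡ (x a b))))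
    ... | no _ | no _ | yes refl = ≤-reflexive (trans (symm a b) (sym (trans (cong (x b a +_) (diag b)) (+-identityʳ (x b a)))))
    ... | no a≢b | no u≢a | no u≢b =
      subst₂ (λ p q → x a b ≤ p + q) (symm a u) (symm b u) (tri a b u a≢b (u≢b ∘ sym) (u≢a ∘ sym))

    -- Each node of `E` lies in k - 1 of its pairs, so bounding every `x a b` by `x u a + x u b`
    -- yields the factor k - 1 on the right; the pair-sum constraint has the same factor on the
    -- left, and it cancels. The node `u` may lie outside `E`.
    D≤sumIn : ∀ E → ∣ E ∣ ≡ k → ∀ u → D E ≤ sumIn E (d u)
    D≤sumIn E ∣E∣ u = ≤-trans (*-mono-≤ˡ 0≤M xE≤) (≤-reflexive (sym (sumIn-* E M (x u))))
      where
      pairs : sumℚ (map (λ (a , b) → x a b) (pairsOf E)) ≤ κ * sumIn E (x u)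
      pairs = ≤-trans (≤-reflexive (sum-pairsOf E (λ (a , b) → x a b)))
        (≤-trans (sumIn-mono E (λ a _ → sumIn-mono E (λ b _ → when-mono (does (a Finₚ.<? b)) (triangle u a b))))
          (≤-reflexive (trans (sum-pairs-+ E (x u))
            (cong (_* sumIn E (x u)) (trans (cong (_- 1ℚ) (ℕtoℚ-k ∣E∣)) (pred κ))))))
        where
        pred : ∀ m → 1ℚ + m - 1ℚ ≡ m
        pred = solve-∀ ℚ-ring
      xE≤ : xE E ≤ sumIn E (x u)
      xE≤ = subst (_≤ sumIn E (x u)) (*-cancel-inverse {κ} {invℕ K} κ*invK) (≤-scale {κ} {invℕ K} (0≤invℕ K) κ*invK
        (≤-trans (≤-reflexive (cong (_* xE E) κ-def)) (≤-trans (sumcon E ∣E∣) pairs)))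

    0≤D : ∀ E → ∣ E ∣ ≡ k → 0ℚ ≤ D E
    0≤D E ∣E∣ = 0≤p*q 0≤M (xE-lo E ∣E∣)

    D≤M : ∀ E → ∣ E ∣ ≡ k → D E ≤ M
    D≤M E ∣E∣ = ≤-trans (*-mono-≤ˡ 0≤M (xE-hi E ∣E∣)) (≤-reflexive (*-identityʳ M))

    d≤d+D : ∀ E → ∣ E ∣ ≡ k → ∀ u {i j} → i ∈ E → j ∈ E → d u j ≤ d u i + D E
    d≤d+D E ∣E∣ u {i} {j} i∈E j∈E = ≤-trans (*-mono-≤ˡ 0≤M bound) (≤-reflexive (*-distribˡ-+ M (x u i) (xE E)))
      where
      bound : x u j ≤ x u i + xE E
      bound with i Finₚ.≟ j
      -- No edge constraint exists for i = j; nonnegativity of `xE E` takes its place.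
      ... | yes refl = subst (_≤ x u i + xE E) (+-identityʳ (x u i)) (+-monoʳ-≤ (x u i) (xE-lo E ∣E∣))
      ... | no i≢j   = ≤-trans (triangle i u j) (+-mono-≤ (≤-reflexive (symm i u)) (edge E ∣E∣ i j i∈E j∈E i≢j))

    LP : Subset n → ℚ
    LP E = w⁺ E * xE E + w⁻ E * (1ℚ - xE E)

    slack : Bool → Subset n → ℚ
    slack uncut E = M * LP E - (if uncut then w⁻ E else w⁺ E)

    -- Since `w⁺ E + w⁻ E = 1`, the slack of a cut set is the convex combination
    -- `w⁺ E * (D E - 1) + w⁻ E * (M - D E)`, so any `c` below both values is below the slack.
    cut-slack : ∀ E → ∣ E ∣ ≡ k → ∀ c → c ≤ D E - 1ℚ → c ≤ M - D E → c ≤ slack false E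
    cut-slack E ∣E∣ c lo hi = subst (_≤ slack false E) (trans (cong (c *_) (w-sum E ∣E∣)) (*-identityʳ c))
      (≤-by (identity M (w⁺ E) (w⁻ E) (xE E) c)
        (0≤p+q (0≤p*q (0≤w⁺ E ∣E∣) (p≤q⇒0≤q-p lo)) (0≤p*q (0≤w⁻ E ∣E∣) (p≤q⇒0≤q-p hi))))
      where
      identity : ∀ M p q y c → M * (p * y + q * (1ℚ - y)) - p - c * (p + q) ≡ p * (M * y - 1ℚ - c) + q * (M - M * y - c)
      identity = solve-∀ ℚ-ring

    -- Here the convex combination is `w⁺ E * D E + w⁻ E * (M - 1 - D E)`.
    uncut-slack : ∀ E → ∣ E ∣ ≡ k → ∀ c → c ≤ D E → c ≤ M - 1ℚ - D E → c ≤ slack true E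
    uncut-slack E ∣E∣ c lo hi = subst (_≤ slack true E) (trans (cong (c *_) (w-sum E ∣E∣)) (*-identityʳ c))
      (≤-by (identity M (w⁺ E) (w⁻ E) (xE E) c)
        (0≤p+q (0≤p*q (0≤w⁺ E ∣E∣) (p≤q⇒0≤q-p lo)) (0≤p*q (0≤w⁻ E ∣E∣) (p≤q⇒0≤q-p hi))))
      where
      identity : ∀ M p q y c → M * (p * y + q * (1ℚ - y)) - q - c * (p + q) ≡ p * (M * y - c) + q * (M - 1ℚ - M * y - c)
      identity = solve-∀ ℚ-ring

    -- During a run `E ⊆ W` means that no earlier cluster has met `E`; if `S` meets it now, this
    -- step decides whether it is cut.
    touched : Subset n → Subset n → Subset n → ℚ
    touched W S E = when (does (E ⊆? W)) (when (does (nonempty? (E ∩ S))) (slack ⌊ E ⊆? S ⌋ E))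

    slack-⊆ : ∀ S E c → (E ⊆ S → c ≤ slack true E) → (¬ (E ⊆ S) → c ≤ slack false E) → c ≤ slack ⌊ E ⊆? S ⌋ E
    slack-⊆ S E c f g with E ⊆? S
    ... | yes E⊆S = f E⊆S
    ... | no  E⊈S = g E⊈S

    ≤-touched : ∀ W S E c →
                (E ⊆ W → ∀ i → i ∈ E → i ∈ S → (E ⊆ S → c ≤ slack true E) × (¬ (E ⊆ S) → c ≤ slack false E)) →
                (¬ (E ⊆ W) → c ≤ 0ℚ) → ((∀ {i} → i ∈ E → i ∉ S) → c ≤ 0ℚ) → c ≤ touched W S E
    ≤-touched W S E c main outside apart =
      ≤-when (E ⊆? W) (λ E⊆W → ≤-when (nonempty? (E ∩ S))
        (λ (i , i∈) → let i∈E , i∈S = x∈p∩q⁻ E S i∈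
                          f , g = main E⊆W i i∈E i∈S
                      in slack-⊆ S E c f g)
        (λ empty → apart (λ i∈E i∈S → empty (_ , x∈p∩q⁺ (i∈E , i∈S)))))
        outside

    -- The step that outputs the pivot together with T.

    module Cluster (u : Fin n) (W S : Subset n) (S⊆W : S ⊆ W)
      (near : ∀ i → i ∈ S → d u i ≤ 2ℚ) (far : ∀ i → i ∈ W → i ∉ S → 2ℚ ≤ d u i)
      (0≤avg : 0ℚ ≤ sumIn S (λ i → 1ℚ - d u i)) where

      a : Fin n → ℚ
      a i = 1ℚ - d u i

      -- These classes need no averaging. If `j ∉ W` then `touched` vanishes on the class. The
      -- threshold 3 is 2 + 1: a node of `S` has distance at most 2, so `D E ≥ d u j - d u i ≥ 1`
      -- and a cut set has nonnegative slack. In all other classes the nodes outside `S` have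
      -- distances between 2 and 3.
      Dominated : Subset n → Set
      Dominated G = ∃ λ j → (j ∈ G × j ∉ S) × (j ∉ W ⊎ 3ℚ ≤ d u j)

      dominated? : ∀ G → Dec (Dominated G)
      dominated? G = Finₚ.any? (λ j → (j ∈? G ×-dec ¬? (j ∈? S)) ×-dec (¬? (j ∈? W) ⊎-dec (3ℚ ≤? d u j)))

      dominated : ∀ G → Dominated G → ∀ E → agree S G E ≡ true → ∣ E ∣ ≡ k → 0ℚ ≤ touched W S E
      dominated G (j , (j∈G , j∉S) , outside-or-far) E ag ∣E∣ = ≤-touched W S E 0ℚ
        (λ E⊆W i i∈E i∈S → (λ E⊆S → ⊥-elim (j∉S (E⊆S j∈E))) ,
          λ _ → cut-slack E ∣E∣ 0ℚ (large-D i i∈E i∈S (3≤d (E⊆W j∈E) outside-or-far))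
                  (p≤q⇒0≤q-p (D≤M E ∣E∣)))
        (λ _ → ≤-refl) (λ _ → ≤-refl)
        where
        j∈E = agree⇒⊇ S G E ag j∈G j∉S
        3≤d : j ∈ W → j ∉ W ⊎ 3ℚ ≤ d u j → 3ℚ ≤ d u j
        3≤d j∈W (inj₁ j∉W) = ⊥-elim (j∉W j∈W)
        3≤d j∈W (inj₂ le)  = le
        cert : ∀ D p q → D - 1ℚ - 0ℚ ≡ (p + D - q) + ((2ℚ - p) + (q - 3ℚ))
        cert = solve-∀ ℚ-ring
        large-D : ∀ i → i ∈ E → i ∈ S → 3ℚ ≤ d u j → 0ℚ ≤ D E - 1ℚ
        large-D i i∈E i∈S le = ≤-by (cert (D E) (d u i) (d u j))
          (0≤p+q (p≤q⇒0≤q-p (d≤d+D E ∣E∣ u i∈E j∈E)) (0≤p+q (p≤q⇒0≤q-p (near i i∈S)) (p≤q⇒0≤q-p le)))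

      module Split (G : Subset n) (¬dom : ¬ Dominated G) {j : Fin n} (j∈G : j ∈ G) (j∉S : j ∉ S)
                   (E : Subset n) (ag : agree S G E ≡ true) (∣E∣ : ∣ E ∣ ≡ k) where
        f g A B : ℚ
        f = ℕtoℚ ∣ E ∩ S ∣
        g = ℕtoℚ ∣ E ─ S ∣
        A = sumIn (E ∩ S) (d u)
        B = sumIn (E ─ S) (d u)

        outside-S : ∀ i → i ∈ G → i ∉ S → i ∈ W × d u i ≤ 3ℚ
        outside-S i i∈G i∉S with i ∈? W | 3ℚ ≤? d u i
        ... | no i∉W  | _      = ⊥-elim (¬dom (i , (i∈G , i∉S) , inj₁ i∉W))
        ... | yes _   | yes le = ⊥-elim (¬dom (i , (i∈G , i∉S) , inj₂ le))
        ... | yes i∈W | no 3≰d = i∈W , <⇒≤ (≰⇒> 3≰d)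

        j∈E : j ∈ E
        j∈E = agree⇒⊇ S G E ag j∈G j∉S

        E⊆W : E ⊆ W
        E⊆W {i} i∈E with i ∈? S
        ... | yes i∈S = S⊆W i∈S
        ... | no  i∉S = proj₁ (outside-S i (agree⇒⊆ S G E ag i∈E i∉S) i∉S)

        f+g : f + g ≡ 1ℚ + κ
        f+g = trans (sym (ℕtoℚ-+ ∣ E ∩ S ∣ ∣ E ─ S ∣)) (ℕtoℚ-k (trans (sym (∣p∣≡∣p∩q∣+∣p─q∣ E S)) ∣E∣))

        A≤2f : A ≤ f * 2ℚ
        A≤2f = ≤-trans (sumIn-mono (E ∩ S) (λ i i∈ → near i (p∩q⊆q E S i∈))) (≤-reflexive (sumIn-const (E ∩ S) 2ℚ))

        B≤3g : B ≤ g * 3ℚ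
        B≤3g = ≤-trans (sumIn-mono (E ─ S) (λ i i∈ →
            let i∉S = x∈p─q⇒x∉q E S i∈ in proj₂ (outside-S i (agree⇒⊆ S G E ag (p─q⊆p E S i∈) i∉S) i∉S)))
          (≤-reflexive (sumIn-const (E ─ S) 3ℚ))

        D≤A+B : D E ≤ A + B
        D≤A+B = ≤-trans (D≤sumIn E ∣E∣ u) (≤-reflexive (sumIn-split E S (d u)))

        0≤f : 0ℚ ≤ f
        0≤f = 0≤ℕtoℚ ∣ E ∩ S ∣

        2≤dj : 2ℚ ≤ d u j
        2≤dj = far j (E⊆W j∈E) j∉S

        -- For each i in `E ∩ S`, `D E ≥ d u j - d u i` and `d u j ≥ 2` give `1 - d u i ≤ D E - 1`;
        -- the claim is the sum of these `f` inequalities.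
        lower : f - A ≤ f * (D E - 1ℚ)
        lower = ≤-by (cert f (D E) (d u j) A) (0≤p+q 0≤Σ (0≤p*q 0≤f (p≤q⇒0≤q-p 2≤dj)))
          where
          cert : ∀ f D q A → f * (D - 1ℚ) - (f - A) ≡ f * (D - q) + A + f * (q - 2ℚ)
          cert = solve-∀ ℚ-ring
          swap : ∀ p D q → p + D - q ≡ D - q + p
          swap = solve-∀ ℚ-ring
          0≤Σ : 0ℚ ≤ f * (D E - d u j) + A
          0≤Σ = subst (0ℚ ≤_) (trans (sumIn-+ (E ∩ S) (λ _ → D E - d u j) (d u)) (cong (_+ A) (sumIn-const (E ∩ S) (D E - d u j))))
            (0≤sumIn (E ∩ S) (λ i i∈ → subst (0ℚ ≤_) (swap (d u i) (D E) (d u j))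
              (p≤q⇒0≤q-p (d≤d+D E ∣E∣ u (p∩q⊆p E S i∈) j∈E))))

        -- After division by `f`, the bounds `D E ≤ A + B`, `B ≤ 3 g` and `A ≤ 2 f` leave
        -- `2 f + g - 3 = (κ - 1) + (f - 1)`, which is nonnegative and vanishes for `f = g = 1`:
        -- this case uses up the whole constant 4 in M. The condition `1 ≤ f` gives `A ≤ 2 f` a
        -- nonnegative coefficient.
        upper : 1ℚ ≤ f → f - A ≤ f * (M - D E)
        upper 1≤f = ≤-by (trans (cong (λ M → f * (M - D E) - (f - A)) M≡4κ) (cert f g (D E) A B κ f+g))
          (0≤p+q (0≤p+q (0≤p+q (0≤p+q
            (0≤p*q 0≤f (p≤q⇒0≤q-p D≤A+B))
            (0≤p*q 0≤f (p≤q⇒0≤q-p B≤3g)))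
            (0≤p*q 0≤f-1 (p≤q⇒0≤q-p A≤2f)))
            (0≤p*q 0≤f (p≤q⇒0≤q-p 1≤κ)))
            (0≤p*q 0≤f 0≤f-1))
          where
          0≤f-1 = p≤q⇒0≤q-p 1≤f
          poly : ∀ f g D A B → f * (4ℚ * (f + g - 1ℚ) - D) - (f - A) ≡
            f * (A + B - D) + f * (g * 3ℚ - B) + (f - 1ℚ) * (f * 2ℚ - A) + f * (f + g - 1ℚ - 1ℚ) + f * (f - 1ℚ)
          poly = solve-∀ ℚ-ring
          κ≡ : ∀ κ → 1ℚ + κ - 1ℚ ≡ κ
          κ≡ = solve-∀ ℚ-ring
          cert : ∀ f g D A B κ → f + g ≡ 1ℚ + κ → f * (4ℚ * κ - D) - (f - A) ≡
            f * (A + B - D) + f * (g * 3ℚ - B) + (f - 1ℚ) * (f * 2ℚ - A) + f * (κ - 1ℚ) + f * (f - 1ℚ)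
          -- The ring solver cannot use the hypothesis `eq`, so the identity is proved with
          -- `f + g - 1` in place of `κ`.
          cert f g D A B κ eq = subst (λ κ → f * (4ℚ * κ - D) - (f - A) ≡
              f * (A + B - D) + f * (g * 3ℚ - B) + (f - 1ℚ) * (f * 2ℚ - A) + f * (κ - 1ℚ) + f * (f - 1ℚ))
            (trans (cong (_- 1ℚ) eq) (κ≡ κ)) (poly f g D A B)

        -- The number of nodes inside `S` depends on the class alone, which gives the common factor
        -- that `class-bound` requires.
        ∣E∩S∣ : ∣ E ∩ S ∣ ≡ k ℕ.∸ ∣ G ─ S ∣
        ∣E∩S∣ = trans (sym (ℕₚ.m+n∸n≡m ∣ E ∩ S ∣ ∣ E ─ S ∣))
          (cong₂ ℕ._∸_ (trans (sym (∣p∣≡∣p∩q∣+∣p─q∣ E S)) ∣E∣) (cong ∣_∣ (agree-─ S G E ag)))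

        bound : invℕ (k ℕ.∸ ∣ G ─ S ∣) * sumIn (E ∩ S) a ≤ touched W S E
        bound = subst₂ (λ m s → invℕ m * s ≤ touched W S E) ∣E∩S∣ (sym (sumIn-1- (E ∩ S) (d u)))
          (≤-touched W S E (μ * (f - A))
            (λ _ i i∈E i∈S → (λ E⊆S → ⊥-elim (j∉S (E⊆S j∈E))) , λ _ → nontrivial i∈E i∈S)
            (λ E⊈W → ⊥-elim (E⊈W E⊆W))
            (λ apart → ≤-reflexive (trans (cong (μ *_) (trans (sym (sumIn-1- (E ∩ S) (d u)))
               (sumIn-zero (E ∩ S) (λ i i∈ → ⊥-elim (apart (p∩q⊆p E S i∈) (p∩q⊆q E S i∈)))))) (*-zeroʳ μ))))
          where
          μ = invℕ ∣ E ∩ S ∣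
          0≤μ = 0≤invℕ ∣ E ∩ S ∣
          positive : ∀ m → 0 ℕ.< m → 1ℚ ≤ ℕtoℚ m × ℕtoℚ m * invℕ m ≡ 1ℚ
          positive (suc m) _ = 1≤ℕtoℚ-suc m , ℕtoℚ*invℕ m
          nontrivial : ∀ {i} → i ∈ E → i ∈ S → μ * (f - A) ≤ slack false E
          nontrivial i∈E i∈S =
            let 1≤f , fμ≡1 = positive ∣ E ∩ S ∣ (ℕₚ.n≢0⇒n>0 (λ eq → ∣p∣≡0⇒∉ (E ∩ S) eq (x∈p∩q⁺ (i∈E , i∈S))))
            in cut-slack E ∣E∣ (μ * (f - A)) (≤-scale {f} {μ} 0≤μ fμ≡1 lower) (≤-scale {f} {μ} 0≤μ fμ≡1 (upper 1≤f))

      split-class : ∀ G → ¬ Dominated G → ∀ {j} → j ∈ G → j ∉ S →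
                    0ℚ ≤ ∑ (λ E → when (agree S G E) (when (does (∣ E ∣ ℕ.≟ k)) (touched W S E)))
      split-class G ¬dom j∈G j∉S = class-bound S G k (touched W S) (invℕ (k ℕ.∸ ∣ G ─ S ∣)) a (0≤invℕ (k ℕ.∸ ∣ G ─ S ∣)) 0≤avg
        (Split.bound G ¬dom j∈G j∉S)

      inside-touched : ∀ E → E ⊆ S → ∣ E ∣ ≡ k → ∀ c → c ≤ D E → c ≤ M - 1ℚ - D E → c ≤ touched W S E
      inside-touched E E⊆S ∣E∣ c lo hi = ≤-touched W S E c
        (λ _ _ _ _ → (λ _ → uncut-slack E ∣E∣ c lo hi) , λ E⊈S → ⊥-elim (E⊈S E⊆S))
        (λ E⊈W → ⊥-elim (E⊈W (λ i∈E → S⊆W (E⊆S i∈E))))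
        (λ apart → let _ , i∈E , _ = ∣p∣≡suc⇒∈ E ∣E∣ in ⊥-elim (apart i∈E (E⊆S i∈E)))

      -- All k nodes are within distance 2, so `D E ≤ 2 κ + 2`, against `M - 1 = 4 κ - 1`. This
      -- needs `2 κ ≥ 3` and fails exactly for pairs.
      inside-large : 2ℚ ≤ κ → ∀ E → E ⊆ S → ∣ E ∣ ≡ k → 0ℚ ≤ touched W S E
      inside-large 2≤κ E E⊆S ∣E∣ = inside-touched E E⊆S ∣E∣ 0ℚ (0≤D E ∣E∣)
        (≤-by (trans (cong (λ M → M - 1ℚ - D E - 0ℚ) M≡4κ) (cert κ (D E)))
          (0≤p+q (p≤q⇒0≤q-p D≤) (0≤p+q (0≤p+q (p≤q⇒0≤q-p 2≤κ) (p≤q⇒0≤q-p 2≤κ)) 0≤1)))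
        where
        D≤ : D E ≤ (1ℚ + κ) * 2ℚ
        D≤ = ≤-trans (D≤sumIn E ∣E∣ u) (≤-trans (sumIn-mono E (λ i i∈E → near i (E⊆S i∈E)))
          (≤-reflexive (trans (sumIn-const E 2ℚ) (cong (_* 2ℚ) (ℕtoℚ-k ∣E∣)))))
        cert : ∀ κ D → 4ℚ * κ - 1ℚ - D - 0ℚ ≡ (1ℚ + κ) * 2ℚ - D + (κ - 2ℚ + (κ - 2ℚ) + 1ℚ)
        cert = solve-∀ ℚ-ring

      -- For k = 2 the pairs inside S are charged to their endpoints j with 1 ≤ d u j: dropping such a j from S
      -- only lowers the average distance to u.
      module Pairs (κ≡1 : κ ≡ 1ℚ) (k≡2 : k ≡ 2) where

        t : ℕ → ℚ
        t m = when (does (m ℕ.≟ k)) 1ℚ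

        -- The condition `agree (S ∖ j) ⁅ j ⁆ E` says that `E` consists of `j` and elements of
        -- `S ∖ j`. For a pair the inner sum is then the value of `a` at the other endpoint; this
        -- form makes the pairs through `j` a class, to which `class-average` over `S ∖ j` applies.
        charge : Subset n → Fin n → ℚ
        charge E j = when (does (1ℚ ≤? d u j)) (when (agree (S ∖ j) ⁅ j ⁆ E) (t ∣ E ∣ * sumIn (E ∩ (S ∖ j)) a))

        0≤∑charge : 0ℚ ≤ ∑ (λ E → sumIn S (charge E))
        0≤∑charge = subst (0ℚ ≤_) (sym (∑-sumIn-swap S charge)) (0≤sumIn S (λ j j∈S → by-distance j j∈S (1ℚ ≤? d u j)))
          where
          cert : ∀ q r → r - 0ℚ ≡ 1ℚ - q + r + (q - 1ℚ)
          cert = solve-∀ ℚ-ring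
          0≤rest : ∀ j → j ∈ S → 1ℚ ≤ d u j → 0ℚ ≤ sumIn (S ∖ j) a
          0≤rest j j∈S 1≤d = ≤-by (cert (d u j) (sumIn (S ∖ j) a))
            (0≤p+q (subst (0ℚ ≤_) (sumIn-remove S a j∈S) 0≤avg) (p≤q⇒0≤q-p 1≤d))
          by-distance : ∀ j → j ∈ S → (far-j : Dec (1ℚ ≤ d u j)) →
            0ℚ ≤ ∑ (λ E → when (does far-j) (when (agree (S ∖ j) ⁅ j ⁆ E) (t ∣ E ∣ * sumIn (E ∩ (S ∖ j)) a)))
          by-distance j j∈S (no _)    = ≤-reflexive (sym (∑-0 n))
          by-distance j j∈S (yes 1≤d) = subst (0ℚ ≤_) (sym (class-average (S ∖ j) ⁅ j ⁆ t a))
            (0≤p*q (0≤coef (S ∖ j) ⁅ j ⁆ (λ m → 0≤when (does (m ℕ.≟ k)) 0≤1)) (0≤rest j j∈S 1≤d))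

        charge-size : ∀ E j → ∣ E ∣ ≢ k → charge E j ≡ 0ℚ
        charge-size E j ∣E∣ = trans (cong (λ q → when far-j (when ag (q * A))) (when-no (∣ E ∣ ℕ.≟ k) 1ℚ ∣E∣))
          (trans (cong (λ q → when far-j (when ag q)) (*-zeroˡ A)) (trans (cong (when far-j) (when-0 ag)) (when-0 far-j)))
          where
          far-j = does (1ℚ ≤? d u j)
          ag = agree (S ∖ j) ⁅ j ⁆ E
          A = sumIn (E ∩ (S ∖ j)) a

        charge-disagree : ∀ E j → agree (S ∖ j) ⁅ j ⁆ E ≢ true → charge E j ≡ 0ℚ
        charge-disagree E j ¬ag with agree (S ∖ j) ⁅ j ⁆ E
        ... | true  = ⊥-elim (¬ag refl)
        ... | false = when-0 (does (1ℚ ≤? d u j))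

        agree⇒⊆S : ∀ E {j} → j ∈ S → agree (S ∖ j) ⁅ j ⁆ E ≡ true → E ⊆ S
        agree⇒⊆S E {j} j∈S ag {i} i∈E with i ∈? (S ∖ j)
        ... | yes i∈ = p─q⊆p S ⁅ j ⁆ i∈
        ... | no  i∉ = subst (_∈ S) (sym (x∈⁅y⁆⇒x≡y j (agree⇒⊆ (S ∖ j) ⁅ j ⁆ E ag i∈E i∉))) j∈S

        agree⇒∈ : ∀ E {j} → agree (S ∖ j) ⁅ j ⁆ E ≡ true → j ∈ E
        agree⇒∈ E {j} ag = agree⇒⊇ (S ∖ j) ⁅ j ⁆ E ag (x∈⁅x⁆ j) (λ j∈ → x∈p∖y⇒x≢y S j∈ refl)

        module Pair (E : Subset n) (E⊆S : E ⊆ S) (∣E∣ : ∣ E ∣ ≡ k) {p q : Fin n} (p∈E : p ∈ E) (q∈E : q ∈ E) (p≢q : p ≢ q)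
                    -- The conclusion contradicts `i ∈ E`: the pair has no third element.
                    (only : ∀ i → i ∈ E → i ≢ p → i ≢ q → i ∉ E) where

          charge-endpoint : ∀ {p q} → p ∈ E → q ∈ E → p ≢ q → (∀ i → i ∈ E → i ≢ p → i ≢ q → i ∉ E) →
                            charge E p ≡ when (does (1ℚ ≤? d u p)) (a q)
          charge-endpoint {p} {q} p∈E q∈E p≢q only = cong (when (does (1ℚ ≤? d u p))) (trans
            (cong₂ (λ b r → when b (r * sumIn (E ∩ (S ∖ p)) a)) ag (when-yes (∣ E ∣ ℕ.≟ k) ∣E∣))
            (trans (*-identityˡ _) (sumIn-single (E ∩ (S ∖ p)) a
              (x∈p∩q⁺ (q∈E , x∈p∧x≢y⇒x∈p-y (E⊆S q∈E) (p≢q ∘ sym)))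
              (λ i i∈ i≢q → let i∈E , i∈S∖p = x∈p∩q⁻ E (S ∖ p) i∈
                            in ⊥-elim (only i i∈E (x∈p∖y⇒x≢y S i∈S∖p) i≢q i∈E)))))
            where
            when-yes : ∀ {P : Set} (p? : Dec P) → P → when (does p?) 1ℚ ≡ 1ℚ
            when-yes (yes _) _ = refl
            when-yes (no ¬p) p = ⊥-elim (¬p p)
            ag : agree (S ∖ p) ⁅ p ⁆ E ≡ true
            ag = agree-intro (S ∖ p) ⁅ p ⁆ E in⇒ (λ i∈ _ → subst (_∈ E) (sym (x∈⁅y⁆⇒x≡y p i∈)) p∈E)
              where
              in⇒ : ∀ {i} → i ∈ E → i ∉ S ∖ p → i ∈ ⁅ p ⁆
              in⇒ {i} i∈E i∉ with i Finₚ.≟ p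
              ... | yes refl = x∈⁅x⁆ p
              ... | no  i≢p  = ⊥-elim (i∉ (x∈p∧x≢y⇒x∈p-y (E⊆S i∈E) i≢p))

          total : sumIn S (charge E) ≡ when (does (1ℚ ≤? d u p)) (a q) + when (does (1ℚ ≤? d u q)) (a p)
          total = trans
            (sumIn-pair S (charge E) (E⊆S p∈E) (E⊆S q∈E) p≢q
              (λ i _ i≢p i≢q → charge-disagree E i (λ ag → let i∈E = agree⇒∈ E ag in only i i∈E i≢p i≢q i∈E)))
            (cong₂ _+_ (charge-endpoint p∈E q∈E p≢q only)
                       (charge-endpoint q∈E p∈E (p≢q ∘ sym) (λ i i∈E i≢q i≢p → only i i∈E i≢p i≢q)))

          D≤ : D E ≤ d u p + d u q
          D≤ = ≤-trans (D≤sumIn E ∣E∣ u) (≤-reflexive (sumIn-pair E (d u) p∈E q∈E p≢q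
            (λ i i∈E i≢p i≢q → ⊥-elim (only i i∈E i≢p i≢q i∈E))))

          M≡4 : M ≡ 4ℚ
          M≡4 = trans M≡4κ (trans (cong (4ℚ *_) κ≡1) (*-identityʳ 4ℚ))

          -- If `1 ≤ d u p`, then `D E ≥ d u p - d u q ≥ 1 - d u q`; and `d u p ≤ 2` gives
          -- `3 - D E ≥ 3 - d u p - d u q ≥ 1 - d u q`.
          one-far : ∀ {p q} → p ∈ E → q ∈ E → D E ≤ d u p + d u q → 1ℚ ≤ d u p → a q ≤ touched W S E
          one-far {p} {q} p∈E q∈E D≤ 1≤dp = inside-touched E E⊆S ∣E∣ (a q)
            (≤-by (cert-lo (D E) (d u p) (d u q)) (0≤p+q (p≤q⇒0≤q-p (d≤d+D E ∣E∣ u q∈E p∈E)) (p≤q⇒0≤q-p 1≤dp)))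
            (≤-by (trans (cong (λ M → M - 1ℚ - D E - a q) M≡4) (cert-hi (D E) (d u p) (d u q)))
              (0≤p+q (p≤q⇒0≤q-p D≤) (p≤q⇒0≤q-p (near p (E⊆S p∈E)))))
            where
            cert-lo : ∀ D p q → D - (1ℚ - q) ≡ q + D - p + (p - 1ℚ)
            cert-lo = solve-∀ ℚ-ring
            cert-hi : ∀ D p q → 4ℚ - 1ℚ - D - (1ℚ - q) ≡ p + q - D + (2ℚ - p)
            cert-hi = solve-∀ ℚ-ring

          bound : sumIn S (charge E) ≤ touched W S E
          bound = subst (_≤ touched W S E) (sym total) (cases (1ℚ ≤? d u p) (1ℚ ≤? d u q))
            where
            cert-lo : ∀ p q → 0ℚ - (1ℚ - q + (1ℚ - p)) ≡ p - 1ℚ + (q - 1ℚ)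
            cert-lo = solve-∀ ℚ-ring
            cert-hi : ∀ D p q → 4ℚ - 1ℚ - D - (1ℚ - q + (1ℚ - p)) ≡ p + q - D + 1ℚ
            cert-hi = solve-∀ ℚ-ring
            cert-0 : ∀ D p q → 4ℚ - 1ℚ - D - (0ℚ + 0ℚ) ≡ p + q - D + (1ℚ - p + (1ℚ - q)) + 1ℚ
            cert-0 = solve-∀ ℚ-ring
            cases : (fp : Dec (1ℚ ≤ d u p)) (fq : Dec (1ℚ ≤ d u q)) →
                    when (does fp) (a q) + when (does fq) (a p) ≤ touched W S E
            -- Both charges are nonpositive, hence below `D E`, and their sum `2 - d u p - d u q` is
            -- below `3 - D E`.
            cases (yes 1≤p) (yes 1≤q) = inside-touched E E⊆S ∣E∣ (a q + a p)
              (≤-trans (≤-by (cert-lo (d u p) (d u q)) (0≤p+q (p≤q⇒0≤q-p 1≤p) (p≤q⇒0≤q-p 1≤q))) (0≤D E ∣E∣))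
              (≤-by (trans (cong (λ M → M - 1ℚ - D E - (a q + a p)) M≡4) (cert-hi (D E) (d u p) (d u q)))
                (0≤p+q (p≤q⇒0≤q-p D≤) 0≤1))
            cases (yes 1≤p) (no _)    = ≤-trans (≤-reflexive (+-identityʳ (a q))) (one-far p∈E q∈E D≤ 1≤p)
            cases (no _)    (yes 1≤q) = ≤-trans (≤-reflexive (+-identityˡ (a p)))
              (one-far q∈E p∈E (≤-trans D≤ (≤-reflexive (+-comm (d u p) (d u q)))) 1≤q)
            -- Nothing is charged, and `D E ≤ d u p + d u q ≤ 2` already makes the slack
            -- nonnegative.
            cases (no 1≰p)  (no 1≰q)  = inside-touched E E⊆S ∣E∣ (0ℚ + 0ℚ) (0≤D E ∣E∣)
              (≤-by (trans (cong (λ M → M - 1ℚ - D E - (0ℚ + 0ℚ)) M≡4) (cert-0 (D E) (d u p) (d u q)))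
                (0≤p+q (0≤p+q (p≤q⇒0≤q-p D≤) (0≤p+q (p≤q⇒0≤q-p (<⇒≤ (≰⇒> 1≰p))) (p≤q⇒0≤q-p (<⇒≤ (≰⇒> 1≰q))))) 0≤1))

        charge≤touched : ∀ E → E ⊆ S → ∣ E ∣ ≡ k → sumIn S (charge E) ≤ touched W S E
        charge≤touched E E⊆S ∣E∣ with ∣p∣≡suc⇒∈ E (trans ∣E∣ k≡2)
        ... | p , p∈E , ∣E∖p∣ with ∣p∣≡suc⇒∈ (E ∖ p) ∣E∖p∣
        ...   | q , q∈E∖p , ∣E∖p∖q∣ = Pair.bound E E⊆S ∣E∣ p∈E (p─q⊆p E ⁅ p ⁆ q∈E∖p) (x∈p∖y⇒x≢y E q∈E∖p ∘ sym)
          (λ i i∈E i≢p i≢q → ⊥-elim (∣p∣≡0⇒∉ ((E ∖ p) ∖ q) ∣E∖p∖q∣ (x∈p∧x≢y⇒x∈p-y (x∈p∧x≢y⇒x∈p-y i∈E i≢p) i≢q)))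

        -- Every `G` inside `S` describes the same class, all subsets of `S`. Charges vanish on
        -- other sets and on other sizes, so the total charge is a lower bound for this class sum.
        inside-class : ∀ G → (∀ j → j ∈ G → j ∈ S) →
                       0ℚ ≤ ∑ (λ E → when (agree S G E) (when (does (∣ E ∣ ℕ.≟ k)) (touched W S E)))
        inside-class G G⊆S = ≤-trans 0≤∑charge (∑-mono (λ E → pointwise E (E ⊆? S) (∣ E ∣ ℕ.≟ k)))
          where
          member : ∀ E → E ⊆ S → agree S G E ≡ true
          member E E⊆S = agree-intro S G E (λ i∈E i∉S → ⊥-elim (i∉S (E⊆S i∈E))) (λ i∈G i∉S → ⊥-elim (i∉S (G⊆S _ i∈G)))
          not-member : ∀ E → ¬ (E ⊆ S) → ∀ r → when (agree S G E) r ≡ 0ℚ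
          not-member E E⊈S r with agree S G E in ag
          ... | false = refl
          ... | true  = ⊥-elim (E⊈S (agree-inside S G E G⊆S ag))
          pointwise : ∀ E → Dec (E ⊆ S) → (s : Dec (∣ E ∣ ≡ k)) → sumIn S (charge E) ≤ when (agree S G E) (when (does s) (touched W S E))
          pointwise E (no E⊈S)  s = ≤-reflexive (trans
            (sumIn-zero S (λ j j∈S → charge-disagree E j (λ ag → E⊈S (agree⇒⊆S E j∈S ag)))) (sym (not-member E E⊈S _)))
          pointwise E (yes E⊆S) (yes ∣E∣) = ≤-trans (charge≤touched E E⊆S ∣E∣)
            (≤-reflexive (cong (λ b → when b (touched W S E)) (sym (member E E⊆S))))
          pointwise E (yes E⊆S) (no ∣E∣)  = ≤-reflexive (trans (sumIn-zero S (λ j _ → charge-size E j ∣E∣)) (sym (when-0 (agree S G E))))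

    size-of-k : (2ℚ ≤ κ) ⊎ (κ ≡ 1ℚ × k ≡ 2)
    size-of-k = by-cases k′ refl
      where
      by-cases : ∀ m → m ≡ k′ → (2ℚ ≤ κ) ⊎ (κ ≡ 1ℚ × k ≡ 2)
      by-cases zero    refl = inj₂ (κ-def , refl)
      by-cases (suc m) refl = inj₁ (subst (2ℚ ≤_) (sym (trans κ-def (ℕtoℚ-suc (suc m)))) (+-monoʳ-≤ 1ℚ (1≤ℕtoℚ-suc m)))

    cluster-step : ∀ u W S → S ⊆ W → (∀ i → i ∈ S → d u i ≤ 2ℚ) → (∀ i → i ∈ W → i ∉ S → 2ℚ ≤ d u i) →
                   0ℚ ≤ sumIn S (λ i → 1ℚ - d u i) → 0ℚ ≤ ∑ (λ E → when (does (∣ E ∣ ℕ.≟ k)) (touched W S E))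
    cluster-step u W S S⊆W near far 0≤avg = ∑-by-classes S _ class
      where
      open Cluster u W S S⊆W near far 0≤avg
      inside : ∀ G → (∀ j → j ∈ G → j ∈ S) → (2ℚ ≤ κ) ⊎ (κ ≡ 1ℚ × k ≡ 2) →
               0ℚ ≤ ∑ (λ E → when (agree S G E) (when (does (∣ E ∣ ℕ.≟ k)) (touched W S E)))
      inside G G⊆S (inj₁ 2≤κ) = class-pointwise S G k (touched W S) (λ E ag ∣E∣ →
        inside-large 2≤κ E (agree-inside S G E G⊆S ag) ∣E∣)
      inside G G⊆S (inj₂ (κ≡1 , k≡2)) = Pairs.inside-class κ≡1 k≡2 G G⊆S
      class : ∀ G → 0ℚ ≤ ∑ (λ E → when (agree S G E) (when (does (∣ E ∣ ℕ.≟ k)) (touched W S E)))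
      class G with dominated? G
      ... | yes dom = class-pointwise S G k (touched W S) (dominated G dom)
      ... | no ¬dom with Finₚ.any? (λ j → j ∈? G ×-dec ¬? (j ∈? S))
      ...   | yes (j , j∈G , j∉S) = split-class G ¬dom j∈G j∉S
      ...   | no  G⊆S = inside G (λ j j∈G → decidable-stable (j ∈? S) (λ j∉S → G⊆S (j , j∈G , j∉S))) size-of-k

    -- The step that outputs the pivot alone.

    module Singleton (u : Fin n) (W T : Subset n) (u∈W : u ∈ W) (u∉T : u ∉ T) (T⊆W : T ⊆ W)
      (near : ∀ i → i ∈ T → d u i ≤ 2ℚ) (far : ∀ i → i ∈ W → i ≢ u → i ∉ T → 2ℚ ≤ d u i)
      (0≤avg : 0ℚ ≤ sumIn T (λ i → d u i - 1ℚ)) where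

      b : Fin n → ℚ
      b i = d u i - 1ℚ

      cut : ∀ E → ∣ E ∣ ≡ k → ¬ (E ⊆ ⁅ u ⁆)
      cut E ∣E∣ E⊆u with subst₂ ℕ._≤_ ∣E∣ (∣⁅x⁆∣≡1 u) (p⊆q⇒∣p∣≤∣q∣ E⊆u)
      ... | ℕ.s≤s ()

      d≤D : ∀ E → ∣ E ∣ ≡ k → u ∈ E → ∀ {i} → i ∈ E → d u i ≤ D E
      d≤D E ∣E∣ u∈E i∈E = ≤-trans (d≤d+D E ∣E∣ u u∈E i∈E) (≤-reflexive (trans (cong (_+ D E) (d-diag u)) (+-identityˡ (D E))))

      ≤-touched-singleton : ∀ E → ∣ E ∣ ≡ k → ∀ c → (u ∈ E → E ⊆ W → c ≤ slack false E) →
                            (¬ (E ⊆ W) → c ≤ 0ℚ) → (u ∉ E → c ≤ 0ℚ) → c ≤ touched W ⁅ u ⁆ E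
      ≤-touched-singleton E ∣E∣ c main outside apart = ≤-touched W ⁅ u ⁆ E c
        (λ E⊆W i i∈E i∈u → (λ E⊆u → ⊥-elim (cut E ∣E∣ E⊆u)) , λ _ → main (subst (_∈ E) (x∈⁅y⁆⇒x≡y u i∈u) i∈E) E⊆W)
        outside
        (λ disjoint → apart (λ u∈E → disjoint u∈E (x∈⁅x⁆ u)))

      module Full (E : Subset n) (∣E∣ : ∣ E ∣ ≡ k) (u∈E : u ∈ E) (E⊆T∪u : ∀ {i} → i ∈ E → i ∉ T → i ≡ u) where
        A : ℚ
        A = sumIn (E ∩ T) (d u)

        E─T : E ─ T ≡ ⁅ u ⁆
        E─T = ⊆-antisym
          (λ {i} i∈ → subst (_∈ ⁅ u ⁆) (sym (E⊆T∪u (p─q⊆p E T i∈) (x∈p─q⇒x∉q E T i∈))) (x∈⁅x⁆ u))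
          (λ {i} i∈ → subst (_∈ E ─ T) (sym (x∈⁅y⁆⇒x≡y u i∈)) (x∈p∧x∉q⇒x∈p─q u∈E u∉T))

        ∣E∩T∣ : ∣ E ∩ T ∣ ≡ K
        ∣E∩T∣ = ℕₚ.suc-injective (trans (sym (ℕₚ.+-comm ∣ E ∩ T ∣ 1))
          (trans (cong (∣ E ∩ T ∣ ℕ.+_) (sym (trans (cong ∣_∣ E─T) (∣⁅x⁆∣≡1 u)))) (trans (sym (∣p∣≡∣p∩q∣+∣p─q∣ E T)) ∣E∣)))

        ∣E∩T∣ℚ : ℕtoℚ ∣ E ∩ T ∣ ≡ κ
        ∣E∩T∣ℚ = trans (cong ℕtoℚ ∣E∩T∣) (sym κ-def)

        sumIn-b : sumIn (E ∩ T) b ≡ A - κ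
        sumIn-b = trans (sumIn--1 (E ∩ T) (d u)) (cong (λ m → A - m) ∣E∩T∣ℚ)

        D≤A : D E ≤ A
        D≤A = ≤-trans (D≤sumIn E ∣E∣ u) (≤-reflexive (trans (sumIn-split E T (d u))
          (trans (cong (A +_) (trans (cong (λ F → sumIn F (d u)) E─T)
            (trans (sumIn-single ⁅ u ⁆ (d u) (x∈⁅x⁆ u) (λ i i∈ i≢u → ⊥-elim (i≢u (x∈⁅y⁆⇒x≡y u i∈)))) (d-diag u))))
            (+-identityʳ A))))

        A≤κ*D : A ≤ κ * D E
        A≤κ*D = ≤-trans (sumIn-mono (E ∩ T) (λ i i∈ → d≤D E ∣E∣ u∈E (p∩q⊆p E T i∈)))
          (≤-reflexive (trans (sumIn-const (E ∩ T) (D E)) (cong (_* D E) ∣E∩T∣ℚ)))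

        A≤2κ : A ≤ κ * 2ℚ
        A≤2κ = ≤-trans (sumIn-mono (E ∩ T) (λ i i∈ → near i (p∩q⊆q E T i∈)))
          (≤-reflexive (trans (sumIn-const (E ∩ T) 2ℚ) (cong (_* 2ℚ) ∣E∩T∣ℚ)))

        -- As `u ∈ E` has distance 0 from itself, `d u i ≤ D E` for every i in `E`; summed over the
        -- κ nodes of `E ∩ T` this is the claim.
        lower : A - κ ≤ κ * (D E - 1ℚ)
        lower = ≤-by (cert κ (D E) A) (p≤q⇒0≤q-p A≤κ*D)
          where
          cert : ∀ κ D A → κ * (D - 1ℚ) - (A - κ) ≡ κ * D - A
          cert = solve-∀ ℚ-ring

        -- There is room here: the average of `d u i - 1` is at most 1, while `D E ≤ A ≤ 2 κ` leaves
        -- `M - D E ≥ 2 κ`.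
        upper : A - κ ≤ κ * (M - D E)
        upper = ≤-by (trans (cong (λ M → κ * (M - D E) - (A - κ)) M≡4κ) (cert κ (D E) A))
          (0≤p+q (0≤p+q (0≤p+q (0≤p+q
            (0≤p*q 0≤κ (p≤q⇒0≤q-p D≤A))
            (0≤p*q 0≤κ (p≤q⇒0≤q-p A≤2κ)))
            (p≤q⇒0≤q-p A≤2κ))
            (0≤p*q (0≤p*q 0≤2 0≤κ) (p≤q⇒0≤q-p 1≤κ)))
            0≤κ)
          where
          0≤2 : 0ℚ ≤ 2ℚ
          0≤2 = 0≤p+q 0≤1 0≤1
          cert : ∀ κ D A → κ * (4ℚ * κ - D) - (A - κ) ≡
            κ * (A - D) + κ * (κ * 2ℚ - A) + (κ * 2ℚ - A) + 2ℚ * κ * (κ - 1ℚ) + κ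
          cert = solve-∀ ℚ-ring

        bound : invℕ K * sumIn (E ∩ T) b ≤ touched W ⁅ u ⁆ E
        bound = subst (λ s → invℕ K * s ≤ touched W ⁅ u ⁆ E) (sym sumIn-b)
          (≤-touched-singleton E ∣E∣ (invℕ K * (A - κ))
            (λ _ _ → cut-slack E ∣E∣ (invℕ K * (A - κ))
              (≤-scale {κ} (0≤invℕ K) κ*invK lower) (≤-scale {κ} (0≤invℕ K) κ*invK upper))
            (λ E⊈W → ⊥-elim (E⊈W E⊆W))
            (λ u∉E → ⊥-elim (u∉E u∈E)))
          where
          E⊆W : E ⊆ W
          E⊆W {i} i∈E with i ∈? T
          ... | yes i∈T = T⊆W i∈T
          ... | no  i∉T = subst (_∈ W) (sym (E⊆T∪u i∈E i∉T)) u∈W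

      -- The pivot lies outside T and so belongs to the common trace: either no set of a class
      -- contains it, and none is touched, or all do.
      singleton-step : 0ℚ ≤ ∑ (λ E → when (does (∣ E ∣ ℕ.≟ k)) (touched W ⁅ u ⁆ E))
      singleton-step = ∑-by-classes T _ class
        where
        class : ∀ G → 0ℚ ≤ ∑ (λ E → when (agree T G E) (when (does (∣ E ∣ ℕ.≟ k)) (touched W ⁅ u ⁆ E)))
        class G with u ∈? G
        ... | no u∉G = class-pointwise T G k (touched W ⁅ u ⁆) (λ E ag ∣E∣ → ≤-touched-singleton E ∣E∣ 0ℚ
            (λ u∈E _ → ⊥-elim (u∉G (agree⇒⊆ T G E ag u∈E u∉T))) (λ _ → ≤-refl) (λ _ → ≤-refl))
        ... | yes u∈G with Finₚ.any? (λ j → (j ∈? G ×-dec ¬? (j ∈? T)) ×-dec ¬? (j Finₚ.≟ u))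
        ...   | yes (j , (j∈G , j∉T) , j≢u) = class-pointwise T G k (touched W ⁅ u ⁆) (λ E ag ∣E∣ →
            let j∈E = agree⇒⊇ T G E ag j∈G j∉T
            in ≤-touched-singleton E ∣E∣ 0ℚ
              (λ u∈E E⊆W → cut-slack E ∣E∣ 0ℚ
                (p≤q⇒0≤q-p (≤-trans 1≤2 (≤-trans (far j (E⊆W j∈E) j≢u j∉T) (d≤D E ∣E∣ u∈E j∈E))))
                (p≤q⇒0≤q-p (D≤M E ∣E∣)))
              (λ _ → ≤-refl) (λ _ → ≤-refl))
          where
          1≤2 : 1ℚ ≤ 2ℚ
          1≤2 = 1≤p+q ≤-refl 0≤1
        ...   | no only-u = class-bound T G k (touched W ⁅ u ⁆) (invℕ K) b (0≤invℕ K) 0≤avg (λ E ag ∣E∣ →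
            Full.bound E ∣E∣ (agree⇒⊇ T G E ag u∈G u∉T)
              (λ {i} i∈E i∉T → decidable-stable (i Finₚ.≟ u) (λ i≢u → only-u (i , (agree⇒⊆ T G E ag i∈E i∉T , i∉T) , i≢u))))

    -- The test of the algorithm and the sum over its steps.

    abstract
      γ : ℚ
      γ = gammaK k

      γ-def : γ ≡ gammaK k
      γ-def = refl

    M*γ : M * γ ≡ 2ℚ
    M*γ = trans (cong (_* γ) M≡4κ) (trans (assoc κ γ)
      (cong (2ℚ *_) (trans (cong₂ _*_ (sym ℕtoℚ-2K) γ-def) (ℕtoℚ*invℕ (k′ ℕ.+ (K ℕ.+ 0))))))
      where
      assoc : ∀ κ γ → 4ℚ * κ * γ ≡ 2ℚ * ((κ + κ) * γ)
      assoc = solve-∀ ℚ-ring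

    -- With `m = ∣ T ∣` this rescales the test: the sum of `d u` over T is compared with the number
    -- of its nodes.
    M*γ½ : ∀ m → M * (γ * ½ * m) ≡ m
    M*γ½ m = trans (assoc M γ ½ m) (trans (cong (λ p → p * ½ * m) M*γ) (*-identityˡ m))
      where
      assoc : ∀ M γ h m → M * (γ * h * m) ≡ M * γ * h * m
      assoc = solve-∀ ℚ-ring

    step-bound : ∀ W u → u ∈ W → 0ℚ ≤ ∑ (λ E → when (does (∣ E ∣ ℕ.≟ k)) (touched W (clusterOf γ ½ x W u) E))
    step-bound W u u∈W = by-case _ refl
      where
      T = Tset γ x W u
      τ = ℕtoℚ ∣ T ∣
      u∉T : u ∉ T
      u∉T u∈T = proj₁ (proj₂ (Tset⁻ γ x W u u∈T)) refl
      T⊆W : T ⊆ W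
      T⊆W i∈T = proj₁ (Tset⁻ γ x W u i∈T)
      near : ∀ i → i ∈ T → d u i ≤ 2ℚ
      near i i∈T = ≤-trans (*-mono-≤ˡ 0≤M (proj₂ (proj₂ (Tset⁻ γ x W u i∈T)))) (≤-reflexive M*γ)
      far : ∀ i → i ∈ W → i ≢ u → i ∉ T → 2ℚ ≤ d u i
      far i i∈W i≢u i∉T = ≤-trans (≤-reflexive (sym M*γ)) (*-mono-≤ˡ 0≤M (<⇒≤ (≰⇒> (λ le → i∉T (Tset⁺ γ x W u i∈W i≢u le)))))
      sum-d : M * sumℚ (map (x u) (members T)) ≡ sumIn T (d u)
      sum-d = trans (cong (M *_) (sum-members T (x u))) (sym (sumIn-* T M (x u)))
      S = ⁅ u ⁆ ∪ T
      u∈S : u ∈ S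
      u∈S = p⊆p∪q T (x∈⁅x⁆ u)
      S∖u : S ∖ u ≡ T
      S∖u = ⊆-antisym
        (λ i∈ → drop-u (x∈p∪q⁻ ⁅ u ⁆ T (p─q⊆p S ⁅ u ⁆ i∈)) (x∈p∖y⇒x≢y S i∈))
        (λ i∈T → x∈p∧x≢y⇒x∈p-y (q⊆p∪q ⁅ u ⁆ T i∈T) (proj₁ (proj₂ (Tset⁻ γ x W u i∈T))))
        where
        drop-u : ∀ {i} → i ∈ ⁅ u ⁆ ⊎ i ∈ T → i ≢ u → i ∈ T
        drop-u (inj₁ i∈u) i≢u = ⊥-elim (i≢u (x∈⁅y⁆⇒x≡y u i∈u))
        drop-u (inj₂ i∈T) _   = i∈T
      S-near : ∀ i → i ∈ S → d u i ≤ 2ℚ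
      S-near i i∈S = [ (λ i∈u → ≤-trans (≤-reflexive (trans (cong (d u) (x∈⁅y⁆⇒x≡y u i∈u)) (d-diag u))) (0≤p+q 0≤1 0≤1))
                     , near i ]′ (x∈p∪q⁻ ⁅ u ⁆ T i∈S)
      S-far : ∀ i → i ∈ W → i ∉ S → 2ℚ ≤ d u i
      S-far i i∈W i∉S = far i i∈W (λ i≡u → i∉S (subst (_∈ S) (sym i≡u) u∈S)) (λ i∈T → i∉S (q⊆p∪q ⁅ u ⁆ T i∈T))
      S⊆W : S ⊆ W
      S⊆W i∈S = [ (λ i∈u → subst (_∈ W) (sym (x∈⁅y⁆⇒x≡y u i∈u)) u∈W) , T⊆W ]′ (x∈p∪q⁻ ⁅ u ⁆ T i∈S)
      -- The test concerns T, the average S: the pivot, at distance 0, contributes 1 to the sum and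
      -- so only helps.
      S-avg : sumIn T (d u) ≤ τ → 0ℚ ≤ sumIn S (λ i → 1ℚ - d u i)
      S-avg le = subst (0ℚ ≤_) (sym (trans (sumIn-remove S (λ i → 1ℚ - d u i) u∈S)
          (cong (λ F → 1ℚ - d u u + sumIn F (λ i → 1ℚ - d u i)) S∖u)))
        (0≤p+q (subst (λ p → 0ℚ ≤ 1ℚ - p) (sym (d-diag u)) 0≤1) (subst (0ℚ ≤_) (sym (sumIn-1- T (d u))) (p≤q⇒0≤q-p le)))
      -- `_<ᵇ_` is the negation of the reversed `_≤ᵇ_`, so `true` is the case of the singleton.
      by-case : ∀ b → (γ * ½ * τ ≤ᵇ sumℚ (map (x u) (members T))) ≡ b →
                0ℚ ≤ ∑ (λ E → when (does (∣ E ∣ ℕ.≟ k)) (touched W (if not b then S else ⁅ u ⁆) E))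
      by-case true  eq = Singleton.singleton-step u W T u∈W u∉T T⊆W near far
        (subst (0ℚ ≤_) (sym (sumIn--1 T (d u))) (p≤q⇒0≤q-p (subst₂ _≤_ (M*γ½ τ) sum-d (*-mono-≤ˡ 0≤M (≡true⇒≤ eq)))))
      by-case false eq = cluster-step u W S S⊆W S-near S-far (S-avg
        (subst₂ _≤_ sum-d (M*γ½ τ) (*-mono-≤ˡ 0≤M (<⇒≤ (≰⇒> (λ le → true≢false (trans (sym (≤⇒≡true le)) eq)))))))
        where
        true≢false : true ≢ false
        true≢false ()

    -- The slack still to be settled when `W` is left and `Ss` will be output. At `W = ⊤` its sum is
    -- M times the LP objective minus the cost; induction along the run shows that sum to be
    -- nonnegative.
    remaining : Subset n → List (Subset n) → Subset n → ℚ
    remaining W Ss E = when (does (∣ E ∣ ℕ.≟ k)) (when (does (E ⊆? W)) (slack (uncutClusters Ss E) E))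

    -- E is accounted for in the step that first meets it.
    remaining-step : ∀ W S Ss → (∀ E → uncutClusters Ss E ≡ true → E ⊆ W ─ S) → ∀ E →
                     remaining (W ─ S) Ss E + when (does (∣ E ∣ ℕ.≟ k)) (touched W S E) ≤ remaining W (S ∷ Ss) E
    remaining-step W S Ss later E = by-size (∣ E ∣ ℕ.≟ k)
      where
      main : ∣ E ∣ ≡ k → (inW : Dec (E ⊆ W)) (inW─S : Dec (E ⊆ W ─ S)) (meets : Dec (∃ λ i → i ∈ E ∩ S)) (inS : Dec (E ⊆ S)) →
             when (does inW─S) (slack (uncutClusters Ss E) E) + when (does inW) (when (does meets) (slack ⌊ inS ⌋ E))
               ≡ when (does inW) (slack (⌊ inS ⌋ ∨ uncutClusters Ss E) E)
      main ∣E∣ (no E⊈W)  (yes E⊆W─S) meets inS = ⊥-elim (E⊈W (λ i∈E → p─q⊆p W S (E⊆W─S i∈E)))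
      main ∣E∣ (no E⊈W)  (no _)      meets inS = refl
      main ∣E∣ (yes E⊆W) (yes E⊆W─S) (yes (i , i∈)) inS = let i∈E , i∈S = x∈p∩q⁻ E S i∈ in ⊥-elim (x∈p─q⇒x∉q W S (E⊆W─S i∈E) i∈S)
      main ∣E∣ (yes E⊆W) (no E⊈)     (no apart) inS =
        ⊥-elim (E⊈ (λ i∈E → x∈p∧x∉q⇒x∈p─q (E⊆W i∈E) (λ i∈S → apart (_ , x∈p∩q⁺ (i∈E , i∈S)))))
      main ∣E∣ (yes E⊆W) (yes _)     (no apart) (yes E⊆S) =
        let i , i∈E , _ = ∣p∣≡suc⇒∈ E ∣E∣ in ⊥-elim (apart (i , x∈p∩q⁺ (i∈E , E⊆S i∈E)))
      main ∣E∣ (yes E⊆W) (yes _)     (no apart) (no _)  = +-identityʳ _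
      main ∣E∣ (yes E⊆W) (no _)      (yes _)    (yes _) = +-identityˡ _
      main ∣E∣ (yes E⊆W) (no E⊈)     (yes _)    (no _) with uncutClusters Ss E in eq
      ... | true  = ⊥-elim (E⊈ (later E eq))
      ... | false = +-identityˡ _
      by-size : (size : Dec (∣ E ∣ ≡ k)) →
        when (does size) (when (does (E ⊆? (W ─ S))) (slack (uncutClusters Ss E) E)) + when (does size) (touched W S E)
          ≤ when (does size) (when (does (E ⊆? W)) (slack (uncutClusters (S ∷ Ss) E) E))
      by-size (no _)    = ≤-refl
      by-size (yes ∣E∣) = ≤-reflexive (main ∣E∣ (E ⊆? W) (E ⊆? (W ─ S)) (nonempty? (E ∩ S)) (E ⊆? S))

    run-bound : ∀ {W Ss} → CGWRun γ ½ x W Ss → 0ℚ ≤ ∑ (remaining W Ss)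
    run-bound done = 0≤∑ {f = remaining ⊥ []} (λ E → ≤-when (∣ E ∣ ℕ.≟ k)
      (λ ∣E∣ → ≤-when (E ⊆? ⊥) (λ E⊆⊥ → ⊥-elim (∉⊥ (E⊆⊥ (proj₁ (proj₂ (∣p∣≡suc⇒∈ E ∣E∣)))))) (λ _ → ≤-refl))
      (λ _ → ≤-refl))
    run-bound (step {W} {Ss} u u∈W run) = ≤-trans
      (subst (0ℚ ≤_) (sym (∑-+ (remaining (W ─ S) Ss) (λ E → when (does (∣ E ∣ ℕ.≟ k)) (touched W S E))))
        (0≤p+q (run-bound run) (step-bound W u u∈W)))
      (∑-mono (remaining-step W S Ss (uncut⇒⊆ run)))
      where
      S = clusterOf γ ½ x W u

    rounding-bound : ∀ {Ss} → CGWRun (gammaK k) ½ x ⊤ Ss →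
                     cost n k w⁺ w⁻ (uncutClusters Ss) ≤ ℕtoℚ (4 ℕ.* K) * LPobj n k w⁺ w⁻ xE
    rounding-bound {Ss} run = subst (λ m → cost n k w⁺ w⁻ (uncutClusters Ss) ≤ m * LPobj n k w⁺ w⁻ xE) M-def
      (0≤q-p⇒p≤q (subst (0ℚ ≤_) total (run-bound (subst (λ γ → CGWRun γ ½ x ⊤ Ss) (sym γ-def) run))))
      where
      size : Subset n → Bool
      size E = does (∣ E ∣ ℕ.≟ k)
      pay : Subset n → ℚ
      pay E = if uncutClusters Ss E then w⁻ E else w⁺ E
      distribute : ∀ b p q → when b (M * p - q) ≡ M * when b p + - 1ℚ * when b q
      distribute true  p q = as-+ M p q
        where
        as-+ : ∀ M p q → M * p - q ≡ M * p + - 1ℚ * q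
        as-+ = solve-∀ ℚ-ring
      distribute false p q = sym (cong₂ _+_ (*-zeroʳ M) (*-zeroʳ (- 1ℚ)))
      inside : ∀ {E : Subset n} (sub : Dec (E ⊆ ⊤)) q → when (does sub) q ≡ q
      inside (yes _) q = refl
      inside (no E⊈) q = ⊥-elim (E⊈ (λ _ → ∈⊤))
      as-- : ∀ p q → p + - 1ℚ * q ≡ p - q
      as-- = solve-∀ ℚ-ring
      total : ∑ (remaining ⊤ Ss) ≡ M * LPobj n k w⁺ w⁻ xE - cost n k w⁺ w⁻ (uncutClusters Ss)
      total = begin
        ∑ (remaining ⊤ Ss)
          ≡⟨ ∑-cong (λ E → trans (cong (when (size E)) (inside (E ⊆? ⊤) _)) (distribute (size E) (LP E) (pay E))) ⟩
        ∑ (λ E → M * when (size E) (LP E) + - 1ℚ * when (size E) (pay E))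
          ≡⟨ ∑-+ (λ E → M * when (size E) (LP E)) (λ E → - 1ℚ * when (size E) (pay E)) ⟩
        ∑ (λ E → M * when (size E) (LP E)) + ∑ (λ E → - 1ℚ * when (size E) (pay E))
          ≡⟨ cong₂ _+_ (∑-* M (λ E → when (size E) (LP E))) (∑-* (- 1ℚ) (λ E → when (size E) (pay E))) ⟩
        M * ∑ (λ E → when (size E) (LP E)) + - 1ℚ * ∑ (λ E → when (size E) (pay E))
          ≡⟨ cong₂ (λ p q → M * p + - 1ℚ * q) (sum-kSubsets n k LP) (sum-kSubsets n k pay) ⟨
        M * LPobj n k w⁺ w⁻ xE + - 1ℚ * cost n k w⁺ w⁻ (uncutClusters Ss)
          ≡⟨ as-- (M * LPobj n k w⁺ w⁻ xE) (cost n k w⁺ w⁻ (uncutClusters Ss)) ⟩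
        M * LPobj n k w⁺ w⁻ xE - cost n k w⁺ w⁻ (uncutClusters Ss)
          ∎
        where open ≡-Reasoning

-- Comparison with an arbitrary clustering.

open import Data.Nat using (ℕ; suc; _≤_; _∸_; _*_; s≤s; z≤n)
open import Data.Rational using (ℚ; 0ℚ; 1ℚ; ½) renaming (_≤_ to _≤ℚ_; _+_ to _+ℚ_; _*_ to _*ℚ_)
open import Data.Fin using (Fin)
open import Data.Fin.Subset using (Subset; ∣_∣; ⊤)
open import Data.List using (List)
open import Relation.Binary.PropositionalEquality using (_≡_; subst)
open import Data.Rational.Properties using (≤-trans)

theorem4 : (n k : ℕ) → 2 ≤ k →
    (w⁺ w⁻ : Subset n → ℚ) →
    (∀ E → ∣ E ∣ ≡ k → 0ℚ ≤ℚ w⁺ E) →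
    (∀ E → ∣ E ∣ ≡ k → 0ℚ ≤ℚ w⁻ E) →
    (∀ E → ∣ E ∣ ≡ k → w⁺ E +ℚ w⁻ E ≡ 1ℚ) →
    (x : Fin n → Fin n → ℚ) (xE : Subset n → ℚ) →
    LPOptimal n k w⁺ w⁻ x xE →
    (Ss : List (Subset n)) → CGWRun (gammaK k) ½ x ⊤ Ss →
    (c : Fin n → ℕ) →
    cost n k w⁺ w⁻ (uncutClusters Ss)
    ≤ℚ ℕtoℚ (4 * (k ∸ 1)) *ℚ cost n k w⁺ w⁻ (uncutLabel c)
theorem4 n (suc (suc k′)) (s≤s (s≤s z≤n)) w⁺ w⁻ 0≤w⁺ 0≤w⁻ w-sum x xE opt Ss run c =
  ≤-trans (rounding-bound run)
    (*-mono-≤ˡ (0≤ℕtoℚ (4 * K)) (subst (LPobj n k w⁺ w⁻ xE ≤ℚ_) (LPobj-labelling k w⁺ w⁻) (optimal dist distE (labelling-feasible K))))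
  where
  open LPOptimal opt using (feasible; optimal)
  open CGW using (*-mono-≤ˡ; 0≤ℕtoℚ)
  open CGW.Rounding k′ w⁺ w⁻ 0≤w⁺ 0≤w⁻ w-sum x xE feasible using (K; k; rounding-bound)
  open CGW.Labelling c using (dist; distE; LPobj-labelling) renaming (feasible to labelling-feasible)
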